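{- For positive integers $\ell,m$, let $A(\ell,m)$ be the $(\ell+m)\times(\ell+m)$ coloring matrix with entries $a_{ij}=0$ if $i,j>\ell$ and $a_{ij}=1$ otherwise. Then for all positive integers $\ell,m,n$ and $1\le i\le\ell$, $$t_{A(\ell,m)}^{(i)}(n)=\frac1n\sum_{k=1}^{n}(m-\ell)^{n-k}\ell^{k-1}\binom{n}{k}\binom{2n+k-2}{k-1};$$ for $\ell+1\le i\le\ell+m$ and $n\ge2$, $$t_{A(\ell,m)}^{(i)}(n)=\frac{1}{n-1}\sum_{k=1}^{n-1}(m-\ell)^{n-k-1}\ell^{k}\binom{n-1}{k}\binom{2n+k-2}{k-1};$$ and for $n\ge2$, $$t_{A(\ell,m)}(n)=\sum_{k=1}^{n}\frac{(2m-\ell)n-mk+(\ell-m)}{n(n-1)}(m-\ell)^{n-k-1}\ell^{k}\binom{n}{k}\binom{2n+k-2}{k-1}.$$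
   Context: A plane tree is an unlabeled rooted tree in which the children of every vertex are linearly ordered. A coloring matrix is a square matrix $A=(a_{ij})$ with entries in $\{0,1\}$. An $A$-coloring of a plane tree assigns to each vertex a color (an index of a row of $A$) such that whenever a vertex of color $j$ is a child of a vertex of color $i$, $a_{ij}=1$. Let $t_A(n)$ be the number of pairs (plane tree with $n$ vertices, $A$-coloring of it) and $t_A^{(i)}(n)$ the number of those with root color $i$. Here $0^0=1$.
   Formalization: In the third formula the k=n term contains (m-ℓ)^(-1), undefined when m=ℓ; for m=ℓ that term is read after cancelling the factor m-ℓ of its numerator (m-ℓ)(n-1); for m≠ℓ the formula is as stated. -}

module Defs where

open import Data.Bool using (if_then_else_; _∧_)
open import Data.Fin using (Fin; toℕ)
open import Data.Fin.Patterns using (0F; 1F)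
open import Data.Integer as ℤ using (ℤ; +_; -[1+_])
open import Data.Integer.Properties using (+-injective; i-j≡0⇒i≡j)
open import Data.List using (List; []; _∷_)
open import Data.List.Relation.Unary.All using (All; []; _∷_)
open import Data.Nat as ℕ using (ℕ; zero; suc; _∸_; _≤ᵇ_; NonZero; NonTrivial; 2+)
open import Data.Nat.Combinatorics using (_C_)
open import Data.Nat.Properties using (m*n≢0)
open import Data.Product using (Σ-syntax; _×_)
open import Data.Rational as ℚ using (ℚ; 0ℚ; 1ℚ; 1/_)
open import Data.Rational.Literals using (fromℤ)
open import Data.Unit using (⊤)
open import Function using (_∘_)
open import Relation.Binary.PropositionalEquality using (_≡_; _≢_)

data PlaneTree : Set where
  node : List PlaneTree → PlaneTree

size       : PlaneTree → ℕ
sizeForest : List PlaneTree → ℕ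
size (node ts) = suc (sizeForest ts)
sizeForest []       = 0
sizeForest (t ∷ ts) = size t ℕ.+ sizeForest ts

-- An assignment of an element of K to every vertex of a tree.  It is stored as
-- a decoration of the tree, not as a function on vertices, so that two
-- assignments are propositionally equal as soon as they agree at every vertex.
data Assignment (K : Set) : PlaneTree → Set where
  node : ∀ {ts} → K → All (Assignment K) ts → Assignment K (node ts)

rootColor : ∀ {K t} → Assignment K t → K
rootColor (node c _) = c

ColoringMatrix : ℕ → Set
ColoringMatrix N = Fin N → Fin N → Fin 2

module _ {N : ℕ} (A : ColoringMatrix N) where

  IsColoring       : ∀ {t} → Assignment (Fin N) t → Set
  -- The first argument is the color of the common parent of the roots.
  IsColoringForest : ∀ {ts} → Fin N → All (Assignment (Fin N)) ts → Set
  IsColoring (node i fs) = IsColoringForest i fs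
  IsColoringForest i []       = ⊤
  IsColoringForest i (f ∷ fs) =
    (A i (rootColor f) ≡ 1F) × IsColoring f × IsColoringForest i fs

  -- t_A(n) is the cardinality of this type.
  ColoredTree : ℕ → Set
  ColoredTree n =
    Σ[ t ∈ PlaneTree ] size t ≡ n ×
    (Σ[ f ∈ Assignment (Fin N) t ] IsColoring f)

  -- t_A^(i)(n) is the cardinality of this type.
  ColoredTreeRootedAt : Fin N → ℕ → Set
  ColoredTreeRootedAt i n =
    Σ[ t ∈ PlaneTree ] size t ≡ n ×
    (Σ[ f ∈ Assignment (Fin N) t ] IsColoring f × rootColor f ≡ i)

-- Colors are numbered from 0, so the condition i > ℓ on 1-based indices
-- becomes ℓ ≤ toℕ i.
A⟨_,_⟩ : ∀ ℓ m → ColoringMatrix (ℓ ℕ.+ m)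
A⟨ ℓ , m ⟩ i j = if (ℓ ≤ᵇ toℕ i) ∧ (ℓ ≤ᵇ toℕ j) then 0F else 1F

∑[1⋯_] : ℕ → (ℕ → ℚ) → ℚ
∑[1⋯ zero  ] f = 0ℚ
∑[1⋯ suc n ] f = ∑[1⋯ n ] f ℚ.+ f (suc n)

_^ℕ_ : ℚ → ℕ → ℚ
q ^ℕ zero  = 1ℚ
q ^ℕ suc e = q ℚ.* (q ^ℕ e)

_^ℤ_ : (q : ℚ) → .{{ℚ.NonZero q}} → ℤ → ℚ
q ^ℤ (+ e)    = q ^ℕ e
q ^ℤ -[1+ e ] = (1/ q) ^ℕ suc e

infixr 8 _^ℕ_ _^ℤ_

fromℕ : ℕ → ℚ
fromℕ n = fromℤ (+ n)

m-ℓ : (ℓ m : ℕ) → ℚ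
m-ℓ ℓ m = fromℤ (+ m ℤ.- + ℓ)

m-ℓ-nonZero : ∀ {ℓ m} → m ≢ ℓ → ℚ.NonZero (m-ℓ ℓ m)
m-ℓ-nonZero {ℓ} {m} m≢ℓ =
  ℤ.≢-nonZero {+ m ℤ.- + ℓ} (m≢ℓ ∘ +-injective ∘ i-j≡0⇒i≡j (+ m) (+ ℓ))

pred-nonZero : ∀ n → .{{NonTrivial n}} → NonZero (n ∸ 1)
pred-nonZero (2+ _) = _

n*pred-nonZero : ∀ n → .{{NonTrivial n}} → NonZero (n ℕ.* (n ∸ 1))
n*pred-nonZero n@(2+ _) = m*n≢0 n (n ∸ 1)

binom[2n+k-2,k-1] : (n k : ℕ) → ℕ
binom[2n+k-2,k-1] n k = (2 ℕ.* n ℕ.+ k ∸ 2) C (k ∸ 1)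

smallRootFormula : (ℓ m n : ℕ) → .{{NonZero n}} → ℚ
smallRootFormula ℓ m n =
  (+ 1 ℚ./ n) ℚ.* ∑[1⋯ n ] λ k →
    m-ℓ ℓ m ^ℕ (n ∸ k) ℚ.* fromℕ ℓ ^ℕ (k ∸ 1)
      ℚ.* fromℕ (n C k) ℚ.* fromℕ (binom[2n+k-2,k-1] n k)

largeRootFormula : (ℓ m n : ℕ) → .{{NonTrivial n}} → ℚ
largeRootFormula ℓ m n =
  (ℚ._/_ (+ 1) (n ∸ 1) {{pred-nonZero n}}) ℚ.* ∑[1⋯ n ∸ 1 ] λ k →
    m-ℓ ℓ m ^ℕ (n ∸ k ∸ 1) ℚ.* fromℕ ℓ ^ℕ k
      ℚ.* fromℕ ((n ∸ 1) C k) ℚ.* fromℕ (binom[2n+k-2,k-1] n k)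

totalNumerator : (ℓ m n k : ℕ) → ℤ
totalNumerator ℓ m n k =
  (+ 2 ℤ.* + m ℤ.- + ℓ) ℤ.* + n ℤ.- + m ℤ.* + k ℤ.+ (+ ℓ ℤ.- + m)

-- The exponent n - k - 1 is -1 at k = n, so the formula makes literal sense
-- only for m ≢ ℓ.
totalFormula : (ℓ m n : ℕ) → .{{NonTrivial n}} → m ≢ ℓ → ℚ
totalFormula ℓ m n m≢ℓ =
  ∑[1⋯ n ] λ k →
    (ℚ._/_ (totalNumerator ℓ m n k) (n ℕ.* (n ∸ 1)) {{n*pred-nonZero n}})
      ℚ.* (_^ℤ_ (m-ℓ ℓ m) {{m-ℓ-nonZero m≢ℓ}} (+ n ℤ.- + k ℤ.- + 1))
      ℚ.* fromℕ ℓ ^ℕ k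
      ℚ.* fromℕ (n C k) ℚ.* fromℕ (binom[2n+k-2,k-1] n k)

-- The same sum with its k = n term split off.  There the numerator is
-- (m - ℓ)(n - 1), whose factor m - ℓ is cancelled against (m - ℓ)^(-1); this
-- is the meaning of the formula when m ≡ ℓ.
totalFormulaCancelled : (ℓ m n : ℕ) → .{{NonTrivial n}} → ℚ
totalFormulaCancelled ℓ m n =
  (∑[1⋯ n ∸ 1 ] λ k →
    (ℚ._/_ (totalNumerator ℓ m n k) (n ℕ.* (n ∸ 1)) {{n*pred-nonZero n}})
      ℚ.* m-ℓ ℓ m ^ℕ (n ∸ k ∸ 1)
      ℚ.* fromℕ ℓ ^ℕ k
      ℚ.* fromℕ (n C k) ℚ.* fromℕ (binom[2n+k-2,k-1] n k))
  ℚ.+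
  (ℚ._/_ (+ (n ∸ 1)) (n ℕ.* (n ∸ 1)) {{n*pred-nonZero n}})
    ℚ.* fromℕ ℓ ^ℕ n
    ℚ.* fromℕ (n C n) ℚ.* fromℕ (binom[2n+k-2,k-1] n n)

{-# OPTIONS --safe #-}
module Submission where

-- Let S and L be the generating functions of the trees whose root has a fixed
-- color below ℓ, respectively at least ℓ.  Then S = x / (1 - ℓ S - m L) and
-- L = x / (1 - ℓ S), so that S = x φ(S) with φ(s) = (1 + (m - ℓ) s) / (1 - ℓ s)².
-- The formulas for S and L are Lagrange inversion.  It is carried out on the
-- coefficients: count n-vertex tuples of forests lying under p parents of small
-- and q parents of large color.  Peeling off the first root gives a recurrence,
-- and the coefficient of sⁿ in φ^(n+p-1) (φ - s φ′) / (1 - ℓ s)^q satisfies the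
-- same recurrence because 1 = Y + ℓ s and X = Y² + ℓ s X + m s Y for
-- X = 1 + (m - ℓ) s and Y = 1 - ℓ s.  The boundary case p = q = 0 and the passage
-- to the stated sums are one termwise absorption identity between binomials.

open import Defs
open import Axiom.UniquenessOfIdentityProofs using (module Decidable⇒UIP)
open import Data.Bool using (Bool; true; false; T)
open import Data.Bool.Properties using (∧-zeroʳ)
open import Data.Empty using (⊥-elim)
open import Data.Fin using (Fin; toℕ; zero; suc; _↑ˡ_; _↑ʳ_)
open import Data.Fin.Patterns using (0F; 1F)
import Data.Fin.Properties as Fin
open import Data.Integer as ℤ using (ℤ)
import Data.Integer.Properties as ℤ
open import Data.List using (List; []; _∷_; map)
open import Data.List.Relation.Unary.All using (All; []; _∷_)
open import Data.Nat as ℕ using (ℕ; zero; suc; 2+; z≤n; s≤s; _∸_; _≤_; _<_; NonZero; NonTrivial)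
open import Data.Nat.Combinatorics using (_C_; nCk+nC[k+1]≡[n+1]C[k+1]; nCk≡nC[n∸k]; k>n⇒nCk≡0)
import Data.Nat.Properties as ℕ
import Data.Nat.Solver as ℕ
open import Data.Product using (Σ; Σ-syntax; _×_; _,_; proj₂; ∃-syntax)
open import Data.Product.Function.Dependent.Propositional using (Σ-↔)
open import Data.Rational as ℚ using (ℚ; 0ℚ; 1ℚ; _+_; _*_; _-_; -_; 1/_; _/_; toℚᵘ)
open import Data.Rational.Literals using (fromℤ)
open import Data.Rational.Properties using (+-assoc; +-comm; +-identityˡ; +-identityʳ; *-assoc; *-identityˡ; *-identityʳ; *-zeroˡ; *-zeroʳ; *-inverseʳ; *-distribˡ-+; toℚᵘ-injective; toℚᵘ-homo-+; toℚᵘ-homo-*; toℚᵘ-homo‿-; toℚᵘ-fromℚᵘ)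
import Data.Rational.Solver as ℚ
import Data.Rational.Unnormalised as ℚᵘ
import Data.Rational.Unnormalised.Properties as ℚᵘ
open import Data.Sum using (_⊎_; inj₁; inj₂)
open import Data.Sum.Function.Propositional using (_⊎-↔_)
open import Data.Unit using (⊤; tt)
open import Function using (_∘_)
open import Function.Bundles using (_↔_; mk↔ₛ′)
open import Function.Properties.Inverse using (↔-refl; ↔-sym; ↔-trans)
open import Function.Related.TypeIsomorphisms using (Σ-distribʳ-⊎)
open import Relation.Binary.PropositionalEquality using (_≡_; _≢_; refl; sym; trans; cong; cong₂; subst; module ≡-Reasoning)
open ≡-Reasoning

-- Recursive decomposition of colored forests

fiber-≡ : ∀ {B : Set} {f : B → ℕ} {n x} {p q : f x ≡ n} →
  _≡_ {A = Σ[ y ∈ B ] f y ≡ n} (x , p) (x , q)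
fiber-≡ {x = x} = cong (x ,_) (ℕ.≡-irrelevant _ _)

module _ {N : ℕ} (A : ColoringMatrix N) where

  ColoredForest : Fin N → Set
  ColoredForest i = Σ[ ts ∈ List PlaneTree ] Σ[ f ∈ All (Assignment (Fin N)) ts ] IsColoringForest A i f

  -- One forest for each listed parent. Tuples, unlike single forests, are closed under removing a
  -- root: its subtrees become one more forest, under a parent of its color.
  ColoredForests : List (Fin N) → Set
  ColoredForests []       = ⊤
  ColoredForests (i ∷ is) = ColoredForest i × ColoredForests is

  -- The parents are not counted, so removing a root lowers the weight by exactly one, and a tree
  -- with `suc n` vertices is a forest of weight `n` under one parent.
  weight : ∀ is → ColoredForests is → ℕ
  weight []       _               = 0
  weight (i ∷ is) ((ts , _) , fs) = sizeForest ts ℕ.+ weight is fs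

  ColoredForestsOfWeight : List (Fin N) → ℕ → Set
  ColoredForestsOfWeight is n = Σ[ fs ∈ ColoredForests is ] weight is fs ≡ n

  no-parents-0 : ColoredForestsOfWeight [] 0 ↔ Fin 1
  no-parents-0 = mk↔ₛ′ (λ _ → 0F) (λ _ → tt , refl) (λ { zero → refl ; (suc ()) }) λ { (tt , refl) → refl }

  no-parents-suc : ∀ n → ColoredForestsOfWeight [] (suc n) ↔ Fin 0
  no-parents-suc n = mk↔ₛ′ (λ { (_ , ()) }) (λ ()) (λ ()) λ { (_ , ()) }

  weight-0-step : ∀ i is → ColoredForestsOfWeight (i ∷ is) 0 ↔ ColoredForestsOfWeight is 0
  weight-0-step i is = mk↔ₛ′
    (λ { ((([] , [] , _) , fs) , e) → fs , e ; (((node _ ∷ _ , _) , _) , ()) })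
    (λ { (fs , e) → (([] , [] , tt) , fs) , e })
    (λ _ → refl)
    (λ { ((([] , [] , _) , fs) , e) → refl ; (((node _ ∷ _ , _) , _) , ()) })

  -- If the first forest is empty, its parent is dropped. Otherwise the root of its first tree, of
  -- color `j`, turns into a new first parent with its own subtrees below it, and the remaining
  -- trees stay under `i`.
  weight-suc-step : ∀ i is n →
    ColoredForestsOfWeight (i ∷ is) (suc n) ↔
      (ColoredForestsOfWeight is (suc n)
        ⊎ (Σ[ j ∈ Fin N ] (A i j ≡ 1F) × ColoredForestsOfWeight (j ∷ i ∷ is) n))
  weight-suc-step i is n = mk↔ₛ′ to from to∘from from∘to
    where
    to : ColoredForestsOfWeight (i ∷ is) (suc n) → _
    to ((([] , [] , _) , fs) , e) = inj₁ (fs , e)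
    to (((node ts ∷ us , node j f ∷ g , a , cf , cg) , fs) , e) =
      inj₂ (j , a , ((ts , f , cf) , (us , g , cg) , fs) ,
        trans (sym (ℕ.+-assoc (sizeForest ts) (sizeForest us) _)) (ℕ.suc-injective e))
    from : _ → ColoredForestsOfWeight (i ∷ is) (suc n)
    from (inj₁ (fs , e)) = (([] , [] , tt) , fs) , e
    from (inj₂ (j , a , ((ts , f , cf) , (us , g , cg) , fs) , e)) =
      ((node ts ∷ us , node j f ∷ g , a , cf , cg) , fs) ,
        cong suc (trans (ℕ.+-assoc (sizeForest ts) (sizeForest us) _) e)
    to∘from : ∀ x → to (from x) ≡ x
    to∘from (inj₁ _) = refl
    to∘from (inj₂ (j , a , fs , e)) = cong (λ e → inj₂ (j , a , fs , e)) (ℕ.≡-irrelevant _ _)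
    from∘to : ∀ x → from (to x) ≡ x
    from∘to ((([] , [] , _) , fs) , e) = refl
    from∘to (((node ts ∷ us , node j f ∷ g , a , cf , cg) , fs) , e) = fiber-≡

  rootedAt↔forests : ∀ i n → ColoredTreeRootedAt A i (suc n) ↔ ColoredForestsOfWeight (i ∷ []) n
  rootedAt↔forests i n = mk↔ₛ′
    (λ { (node ts , e , node _ f , cf , refl) →
           ((ts , f , cf) , tt) , trans (ℕ.+-identityʳ _) (ℕ.suc-injective e) })
    (λ { (((ts , f , cf) , tt) , e) →
           node ts , cong suc (trans (sym (ℕ.+-identityʳ _)) e) , node i f , cf , refl })
    (λ { (((ts , f , cf) , tt) , e) → fiber-≡ })
    (λ { (node ts , e , node _ f , cf , refl) →
           cong (λ e → node ts , e , node i f , cf , refl) (ℕ.≡-irrelevant _ _) })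

  coloredTree↔rootedAt : ∀ n → ColoredTree A n ↔ (Σ[ i ∈ Fin N ] ColoredTreeRootedAt A i n)
  coloredTree↔rootedAt n = mk↔ₛ′
    (λ { (t , e , f , cf) → rootColor f , t , e , f , cf , refl })
    (λ { (_ , t , e , f , cf , _) → t , e , f , cf })
    (λ { (_ , _ , _ , _ , _ , refl) → refl })
    (λ _ → refl)

-- Counting the forests for `A⟨ ℓ , m ⟩`

Σ-const-↔ : ∀ {k c} {P : Fin k → Set} → (∀ j → P j ↔ Fin c) → Σ (Fin k) P ↔ Fin (k ℕ.* c)
Σ-const-↔ P↔ = ↔-trans (Σ-↔ ↔-refl (λ {j} → P↔ j)) (↔-sym Fin.*↔×)

Σ-Fin-+-↔ : ∀ {k k′ c c′} {P : Fin (k ℕ.+ k′) → Set} →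
  (∀ j → P (j ↑ˡ k′) ↔ Fin c) → (∀ j → P (k ↑ʳ j) ↔ Fin c′) →
  Σ (Fin (k ℕ.+ k′)) P ↔ Fin (k ℕ.* c ℕ.+ k′ ℕ.* c′)
Σ-Fin-+-↔ P↔ P↔′ =
  ↔-trans (↔-sym (Σ-↔ (↔-sym Fin.+↔⊎) ↔-refl))
    (↔-trans Σ-distribʳ-⊎ (↔-trans (Σ-const-↔ P↔ ⊎-↔ Σ-const-↔ P↔′) (↔-sym Fin.+↔⊎)))

≡-guard-↔ : ∀ {x : Fin 2} {X : Set} → x ≡ 1F → ((x ≡ 1F) × X) ↔ X
≡-guard-↔ x≡1 = mk↔ₛ′ proj₂ (x≡1 ,_) (λ _ → refl)
  (λ { (e , y) → cong (_, y) (Decidable⇒UIP.≡-irrelevant Fin._≟_ x≡1 e) })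

≢-guard-↔ : ∀ {x : Fin 2} {X : Set} → x ≡ 0F → ((x ≡ 1F) × X) ↔ Fin 0
≢-guard-↔ refl = mk↔ₛ′ (λ { (() , _) }) (λ ()) (λ ()) (λ { (() , _) })

module _ (ℓ m : ℕ) where

  isLarge : Fin (ℓ ℕ.+ m) → Bool
  isLarge i = ℓ ℕ.≤ᵇ toℕ i

  isLarge-< : ∀ i → toℕ i < ℓ → isLarge i ≡ false
  isLarge-< i i<ℓ with ℓ ℕ.≤ᵇ toℕ i in eq
  ... | false = refl
  ... | true  = ⊥-elim (ℕ.<⇒≱ i<ℓ (ℕ.≤ᵇ⇒≤ ℓ (toℕ i) (subst T (sym eq) tt)))

  isLarge-≥ : ∀ i → ℓ ≤ toℕ i → isLarge i ≡ true
  isLarge-≥ i ℓ≤i with ℓ ℕ.≤ᵇ toℕ i | ℕ.≤⇒≤ᵇ ℓ≤i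
  ... | true | _ = refl

  isLarge-↑ˡ : ∀ j → isLarge (j ↑ˡ m) ≡ false
  isLarge-↑ˡ j = isLarge-< (j ↑ˡ m) (subst (_< ℓ) (sym (Fin.toℕ-↑ˡ j m)) (Fin.toℕ<n j))

  isLarge-↑ʳ : ∀ j → isLarge (ℓ ↑ʳ j) ≡ true
  isLarge-↑ʳ j = isLarge-≥ (ℓ ↑ʳ j) (subst (ℓ ≤_) (sym (Fin.toℕ-↑ʳ ℓ j)) (ℕ.m≤m+n ℓ _))

  small-parent : ∀ i j → isLarge i ≡ false → A⟨ ℓ , m ⟩ i j ≡ 1F
  small-parent i j eq rewrite eq = refl

  small-child : ∀ i j → isLarge j ≡ false → A⟨ ℓ , m ⟩ i j ≡ 1F
  small-child i j eq rewrite eq | ∧-zeroʳ (isLarge i) = refl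

  large-large : ∀ i j → isLarge i ≡ true → isLarge j ≡ true → A⟨ ℓ , m ⟩ i j ≡ 0F
  large-large i j eq eq′ rewrite eq | eq′ = refl

  -- The flags tell, for each parent of the forests, whether its color is large.
  forestCount : ℕ → List Bool → ℕ
  forestCount zero    _            = 1
  forestCount (suc n) []           = 0
  forestCount (suc n) (false ∷ bs) = forestCount (suc n) bs
    ℕ.+ (ℓ ℕ.* forestCount n (false ∷ false ∷ bs) ℕ.+ m ℕ.* forestCount n (true ∷ false ∷ bs))
  forestCount (suc n) (true ∷ bs)  = forestCount (suc n) bs
    ℕ.+ (ℓ ℕ.* forestCount n (false ∷ true ∷ bs) ℕ.+ m ℕ.* 0)

  -- The flag `b` is a variable tied to `i` by an equation, so that matching on it makes
  -- `forestCount` reduce. The other two hypotheses are the inductive ones: lower weight with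
  -- arbitrary parents, and equal weight with one parent fewer.
  forests↔Fin-suc : ∀ {n} i is {b} → isLarge i ≡ b →
    (∀ is → ColoredForestsOfWeight A⟨ ℓ , m ⟩ is n ↔ Fin (forestCount n (map isLarge is))) →
    ColoredForestsOfWeight A⟨ ℓ , m ⟩ is (suc n) ↔ Fin (forestCount (suc n) (map isLarge is)) →
    ColoredForestsOfWeight A⟨ ℓ , m ⟩ (i ∷ is) (suc n)
      ↔ Fin (forestCount (suc n) (b ∷ map isLarge is))
  forests↔Fin-suc {n} i is {b} i-eq ih ih′ =
    ↔-trans (weight-suc-step _ i is n) (↔-trans (ih′ ⊎-↔ children b i-eq) (split b))
    where
    subtrees : ∀ {b c} j → isLarge i ≡ b → isLarge j ≡ c →
      ColoredForestsOfWeight A⟨ ℓ , m ⟩ (j ∷ i ∷ is) n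
        ↔ Fin (forestCount n (c ∷ b ∷ map isLarge is))
    subtrees j refl refl = ih (j ∷ i ∷ is)

    childCount : Bool → ℕ
    childCount false = ℓ ℕ.* forestCount n (false ∷ false ∷ map isLarge is)
                         ℕ.+ m ℕ.* forestCount n (true ∷ false ∷ map isLarge is)
    -- The absent large children appear as `m ℕ.* 0` because this is the cardinality that
    -- `Σ-Fin-+-↔` yields.
    childCount true  = ℓ ℕ.* forestCount n (false ∷ true ∷ map isLarge is) ℕ.+ m ℕ.* 0

    split : ∀ b → (Fin (forestCount (suc n) (map isLarge is)) ⊎ Fin (childCount b))
      ↔ Fin (forestCount (suc n) (b ∷ map isLarge is))
    -- Both clauses have the same proof; the match is what unfolds `forestCount`.
    split false = ↔-sym Fin.+↔⊎
    split true  = ↔-sym Fin.+↔⊎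

    Child : Fin (ℓ ℕ.+ m) → Set
    Child j = (A⟨ ℓ , m ⟩ i j ≡ 1F) × ColoredForestsOfWeight A⟨ ℓ , m ⟩ (j ∷ i ∷ is) n

    children : ∀ b → isLarge i ≡ b → Σ (Fin (ℓ ℕ.+ m)) Child ↔ Fin (childCount b)
    children false i-eq = Σ-Fin-+-↔ {P = Child}
      (λ j → ↔-trans (≡-guard-↔ (small-parent i (j ↑ˡ m) i-eq)) (subtrees (j ↑ˡ m) i-eq (isLarge-↑ˡ j)))
      (λ j → ↔-trans (≡-guard-↔ (small-parent i (ℓ ↑ʳ j) i-eq)) (subtrees (ℓ ↑ʳ j) i-eq (isLarge-↑ʳ j)))
    children true i-eq = Σ-Fin-+-↔ {P = Child}
      (λ j → ↔-trans (≡-guard-↔ (small-child i (j ↑ˡ m) (isLarge-↑ˡ j))) (subtrees (j ↑ˡ m) i-eq (isLarge-↑ˡ j)))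
      (λ j → ≢-guard-↔ (large-large i (ℓ ↑ʳ j) i-eq (isLarge-↑ʳ j)))

  -- Lexicographic induction, first on the weight and then on the list of parents: the list grows
  -- only when the weight drops.
  forests↔Fin : ∀ n is →
    ColoredForestsOfWeight A⟨ ℓ , m ⟩ is n ↔ Fin (forestCount n (map isLarge is))
  forests↔Fin zero    []       = no-parents-0 A⟨ ℓ , m ⟩
  forests↔Fin (suc n) []       = no-parents-suc A⟨ ℓ , m ⟩ n
  forests↔Fin zero    (i ∷ is) = ↔-trans (weight-0-step _ i is) (forests↔Fin zero is)
  forests↔Fin (suc n) (i ∷ is) =
    forests↔Fin-suc i is refl (forests↔Fin n) (forests↔Fin (suc n) is)

  rootedAt↔Fin : ∀ i n {b} → isLarge i ≡ b →
    ColoredTreeRootedAt A⟨ ℓ , m ⟩ i (suc n) ↔ Fin (forestCount n (b ∷ []))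
  rootedAt↔Fin i n refl = ↔-trans (rootedAt↔forests _ i n) (forests↔Fin n (i ∷ []))

  coloredTree↔Fin : ∀ n → ColoredTree A⟨ ℓ , m ⟩ (suc n)
    ↔ Fin (ℓ ℕ.* forestCount n (false ∷ []) ℕ.+ m ℕ.* forestCount n (true ∷ []))
  coloredTree↔Fin n = ↔-trans (coloredTree↔rootedAt _ (suc n)) (Σ-Fin-+-↔
    (λ j → rootedAt↔Fin (j ↑ˡ m) n (isLarge-↑ˡ j))
    (λ j → rootedAt↔Fin (ℓ ↑ʳ j) n (isLarge-↑ʳ j)))

-- Rational arithmetic and binomial coefficients

fromℤ-+ : ∀ i j → fromℤ (i ℤ.+ j) ≡ fromℤ i + fromℤ j
fromℤ-+ i j = toℚᵘ-injective (ℚᵘ.≃-trans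
  (ℚᵘ.*≡* (cong (ℤ._* ℤ.+ 1) (sym (cong₂ ℤ._+_ (ℤ.*-identityʳ i) (ℤ.*-identityʳ j)))))
  (ℚᵘ.≃-sym (toℚᵘ-homo-+ (fromℤ i) (fromℤ j))))

fromℤ-* : ∀ i j → fromℤ (i ℤ.* j) ≡ fromℤ i * fromℤ j
fromℤ-* i j = toℚᵘ-injective (ℚᵘ.≃-trans (ℚᵘ.*≡* refl)
  (ℚᵘ.≃-sym (toℚᵘ-homo-* (fromℤ i) (fromℤ j))))

fromℤ-neg : ∀ i → fromℤ (ℤ.- i) ≡ - fromℤ i
fromℤ-neg i = toℚᵘ-injective (ℚᵘ.≃-trans (ℚᵘ.*≡* refl) (ℚᵘ.≃-sym (toℚᵘ-homo‿- (fromℤ i))))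

fromℤ-- : ∀ i j → fromℤ (i ℤ.- j) ≡ fromℤ i - fromℤ j
fromℤ-- i j = trans (fromℤ-+ i (ℤ.- j)) (cong (fromℤ i +_) (fromℤ-neg j))

fromℕ-+ : ∀ i j → fromℕ (i ℕ.+ j) ≡ fromℕ i + fromℕ j
fromℕ-+ i j = fromℤ-+ (ℤ.+ i) (ℤ.+ j)

fromℕ-* : ∀ i j → fromℕ (i ℕ.* j) ≡ fromℕ i * fromℕ j
fromℕ-* i j = trans (cong fromℤ (ℤ.pos-* i j)) (fromℤ-* (ℤ.+ i) (ℤ.+ j))

/-*-cancel : ∀ i n .{{_ : NonZero n}} → (i / n) * fromℕ n ≡ fromℤ i
/-*-cancel i n@(suc k) = toℚᵘ-injective (ℚᵘ.≃-trans (toℚᵘ-homo-* (i / n) (fromℕ n))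
  (ℚᵘ.≃-trans (ℚᵘ.*-congʳ {toℚᵘ (fromℕ n)} (toℚᵘ-fromℚᵘ (ℚᵘ.mkℚᵘ i k)))
  (ℚᵘ.*≡* (trans (ℤ.*-identityʳ _) (cong (λ d → i ℤ.* ℤ.+ d) (sym (ℕ.*-identityʳ n)))))))

*-solve : ∀ x n .{{_ : NonZero n}} y → fromℕ n * x ≡ y → x ≡ (ℤ.+ 1 / n) * y
*-solve x n y eq = begin
  x                           ≡⟨ *-identityˡ x ⟨
  1ℚ * x                      ≡⟨ cong (_* x) (/-*-cancel (ℤ.+ 1) n) ⟨
  (ℤ.+ 1 / n) * fromℕ n * x     ≡⟨ *-assoc (ℤ.+ 1 / n) (fromℕ n) x ⟩
  (ℤ.+ 1 / n) * (fromℕ n * x)   ≡⟨ cong ((ℤ.+ 1 / n) *_) eq ⟩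
  (ℤ.+ 1 / n) * y               ∎

-- The absorption identity, by induction through Pascal's rule.
[1+k]*[1+n]C[1+k]≡[1+n]*nCk : ∀ n k → suc k ℕ.* (suc n C suc k) ≡ suc n ℕ.* (n C k)
[1+k]*[1+n]C[1+k]≡[1+n]*nCk zero    zero    = refl
[1+k]*[1+n]C[1+k]≡[1+n]*nCk zero    (suc k) = begin
  suc (suc k) ℕ.* (1 C suc (suc k)) ≡⟨ cong (suc (suc k) ℕ.*_) (k>n⇒nCk≡0 {1} {suc (suc k)} (s≤s (s≤s z≤n))) ⟩
  suc (suc k) ℕ.* 0                 ≡⟨ ℕ.*-zeroʳ (suc (suc k)) ⟩
  0                                 ≡⟨ k>n⇒nCk≡0 {0} {suc k} (s≤s z≤n) ⟨
  0 C suc k                         ≡⟨ ℕ.*-identityˡ _ ⟨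
  1 ℕ.* (0 C suc k)                 ∎
[1+k]*[1+n]C[1+k]≡[1+n]*nCk (suc n) zero = begin
  1 ℕ.* (suc (suc n) C 1)            ≡⟨ cong (1 ℕ.*_) (nCk+nC[k+1]≡[n+1]C[k+1] (suc n) 0) ⟨
  1 ℕ.* (1 ℕ.+ (suc n C 1))          ≡⟨ ℕ.*-identityˡ _ ⟩
  1 ℕ.+ (suc n C 1)                  ≡⟨ cong (1 ℕ.+_) (ℕ.*-identityˡ _) ⟨
  1 ℕ.+ 1 ℕ.* (suc n C 1)            ≡⟨ cong (1 ℕ.+_) ([1+k]*[1+n]C[1+k]≡[1+n]*nCk n 0) ⟩
  1 ℕ.+ suc n ℕ.* 1                  ∎
[1+k]*[1+n]C[1+k]≡[1+n]*nCk (suc n) (suc k) = begin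
  suc (suc k) ℕ.* (suc (suc n) C suc (suc k))
    ≡⟨ cong (suc (suc k) ℕ.*_) (nCk+nC[k+1]≡[n+1]C[k+1] (suc n) (suc k)) ⟨
  suc (suc k) ℕ.* (c ℕ.+ d)
    ≡⟨ solve 3 (λ k c d → (con 1 :+ k) :* (c :+ d) := c :+ k :* c :+ (con 1 :+ k) :* d) refl (suc k) c d ⟩
  -- One copy of `c` is set aside: at the end it raises the factor `suc n` to `suc (suc n)`.
  c ℕ.+ suc k ℕ.* c ℕ.+ suc (suc k) ℕ.* d
    ≡⟨ cong₂ (λ x y → c ℕ.+ x ℕ.+ y) ([1+k]*[1+n]C[1+k]≡[1+n]*nCk n k) ([1+k]*[1+n]C[1+k]≡[1+n]*nCk n (suc k)) ⟩
  c ℕ.+ suc n ℕ.* (n C k) ℕ.+ suc n ℕ.* (n C suc k)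
    ≡⟨ solve 4 (λ n c x y → c :+ n :* x :+ n :* y := c :+ n :* (x :+ y)) refl (suc n) c (n C k) (n C suc k) ⟩
  c ℕ.+ suc n ℕ.* ((n C k) ℕ.+ (n C suc k))
    ≡⟨ cong (λ x → c ℕ.+ suc n ℕ.* x) (nCk+nC[k+1]≡[n+1]C[k+1] n k) ⟩
  suc (suc n) ℕ.* c ∎
  where
  open ℕ.+-*-Solver
  c = suc n C suc k
  d = suc n C suc (suc k)

-- The equation for `k` replaces a truncated subtraction. For positive i, add (n+1) C(n, i-1) to
-- both sides: by Pascal's rule the left becomes (i + k) C(n+1, i), and absorption identifies i
-- C(n+1, i) with the added term.
[1+n]*nCk≡[1+n-k]*[1+n]Ck : ∀ n i k → i ℕ.+ k ≡ suc n → suc n ℕ.* (n C i) ≡ k ℕ.* (suc n C i)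
[1+n]*nCk≡[1+n-k]*[1+n]Ck n zero    k refl = refl
[1+n]*nCk≡[1+n-k]*[1+n]Ck n (suc i) k eq =
  ℕ.+-cancelˡ-≡ (suc n ℕ.* (n C i)) _ _ (begin
    suc n ℕ.* (n C i) ℕ.+ suc n ℕ.* (n C suc i) ≡⟨ ℕ.*-distribˡ-+ (suc n) (n C i) (n C suc i) ⟨
    suc n ℕ.* ((n C i) ℕ.+ (n C suc i))         ≡⟨ cong₂ ℕ._*_ (sym eq) (nCk+nC[k+1]≡[n+1]C[k+1] n i) ⟩
    (suc i ℕ.+ k) ℕ.* c                         ≡⟨ ℕ.*-distribʳ-+ c (suc i) k ⟩
    suc i ℕ.* c ℕ.+ k ℕ.* c                     ≡⟨ cong (ℕ._+ k ℕ.* c) ([1+k]*[1+n]C[1+k]≡[1+n]*nCk n i) ⟩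
    suc n ℕ.* (n C i) ℕ.+ k ℕ.* c               ∎)
  where
  c = suc n C suc i

-- The coefficient form of differentiating (1 - s)^-(β+1). Both sides equal (β+j+1) C(β+j, j).
[1+j]*[β+1+j]C[1+j]≡[1+β]*[1+β+j]Cj : ∀ β j →
  suc j ℕ.* ((β ℕ.+ suc j) C suc j) ≡ suc β ℕ.* ((suc β ℕ.+ j) C j)
[1+j]*[β+1+j]C[1+j]≡[1+β]*[1+β+j]Cj β j = begin
  suc j ℕ.* ((β ℕ.+ suc j) C suc j)    ≡⟨ cong (λ x → suc j ℕ.* (x C suc j)) (ℕ.+-suc β j) ⟩
  suc j ℕ.* (suc (β ℕ.+ j) C suc j)    ≡⟨ [1+k]*[1+n]C[1+k]≡[1+n]*nCk (β ℕ.+ j) j ⟩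
  suc (β ℕ.+ j) ℕ.* ((β ℕ.+ j) C j)    ≡⟨ [1+n]*nCk≡[1+n-k]*[1+n]Ck (β ℕ.+ j) j (suc β)
                                            (trans (ℕ.+-suc j β) (cong suc (ℕ.+-comm j β))) ⟩
  suc β ℕ.* (suc (β ℕ.+ j) C j)        ∎

-- Lagrange inversion for φ = (1 + a s) / (1 - b s)²

open ℚ.+-*-Solver

-- Sequences stand for power series in s: `shift` is multiplication by s and `conv` is the Cauchy
-- product.
shift : (ℕ → ℚ) → ℕ → ℚ
shift f zero    = 0ℚ
shift f (suc n) = f n

conv : (ℕ → ℚ) → (ℕ → ℚ) → ℕ → ℚ
conv f g zero    = f 0 * g 0
conv f g (suc n) = f (suc n) * g 0 + conv f (g ∘ suc) n

conv-cong : ∀ {f f′ g g′} → (∀ n → f n ≡ f′ n) → (∀ n → g n ≡ g′ n) → ∀ n → conv f g n ≡ conv f′ g′ n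
conv-cong f≡ g≡ zero    = cong₂ _*_ (f≡ 0) (g≡ 0)
conv-cong f≡ g≡ (suc n) =
  cong₂ _+_ (cong₂ _*_ (f≡ (suc n)) (g≡ 0)) (conv-cong f≡ (g≡ ∘ suc) n)

conv-shiftʳ : ∀ f g n → conv f (shift g) n ≡ shift (conv f g) n
conv-shiftʳ f g zero    = *-zeroʳ (f 0)
conv-shiftʳ f g (suc n) =
  trans (cong (_+ conv f g n) (*-zeroʳ (f (suc n)))) (+-identityˡ _)

conv-unfold : ∀ f g n → conv f g n ≡ f n * g 0 + shift (conv f (g ∘ suc)) n
conv-unfold f g zero    = sym (+-identityʳ _)
conv-unfold f g (suc n) = refl

-- `conv` recurses by dropping the constant term of its second factor, so a shift of the first
-- factor takes an induction in which `g` varies.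
conv-shiftˡ : ∀ f g n → conv (shift f) g n ≡ shift (conv f g) n
conv-shiftˡ f g zero    = *-zeroˡ (g 0)
conv-shiftˡ f g (suc n) =
  trans (cong (f n * g 0 +_) (conv-shiftˡ f (g ∘ suc) n)) (sym (conv-unfold f g n))

conv-linearˡ : ∀ c f f′ g n → conv (λ i → f i + c * f′ i) g n ≡ conv f g n + c * conv f′ g n
conv-linearˡ c f f′ g zero =
  solve 4 (λ c f f′ g → (f :+ c :* f′) :* g := f :* g :+ c :* (f′ :* g)) refl c (f 0) (f′ 0) (g 0)
conv-linearˡ c f f′ g (suc n) = trans
  (cong ((f (suc n) + c * f′ (suc n)) * g 0 +_) (conv-linearˡ c f f′ (g ∘ suc) n))
  (solve 6 (λ c f f′ g x y → (f :+ c :* f′) :* g :+ (x :+ c :* y) := f :* g :+ x :+ c :* (f′ :* g :+ y)) refl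
    c (f (suc n)) (f′ (suc n)) (g 0) (conv f (g ∘ suc) n) (conv f′ (g ∘ suc) n))

conv-linearʳ : ∀ c f g g′ n → conv f (λ j → g j + c * g′ j) n ≡ conv f g n + c * conv f g′ n
conv-linearʳ c f g g′ zero =
  solve 4 (λ c f g g′ → f :* (g :+ c :* g′) := f :* g :+ c :* (f :* g′)) refl c (f 0) (g 0) (g′ 0)
conv-linearʳ c f g g′ (suc n) = trans
  (cong (f (suc n) * (g 0 + c * g′ 0) +_) (conv-linearʳ c f (g ∘ suc) (g′ ∘ suc) n))
  (solve 6 (λ c f g g′ x y → f :* (g :+ c :* g′) :+ (x :+ c :* y) := f :* g :+ x :+ c :* (f :* g′ :+ y)) refl
    c (f (suc n)) (g 0) (g′ 0) (conv f (g ∘ suc) n) (conv f (g′ ∘ suc) n))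

-- The hypothesis is restricted to i + j ≡ n because the termwise identity in `D-weighted` relies on
-- that equation.
conv-termwise : ∀ N p r f f′ g g′ n →
  (∀ i j → i ℕ.+ j ≡ n → N * (f i * g j) ≡ p * (f′ i * g j) + r * (f′ i * g′ j)) →
  N * conv f g n ≡ p * conv f′ g n + r * conv f′ g′ n
conv-termwise N p r f f′ g g′ zero    eq = eq 0 0 refl
conv-termwise N p r f f′ g g′ (suc n) eq = begin
  N * (x + conv f (g ∘ suc) n)          ≡⟨ *-distribˡ-+ N x _ ⟩
  N * x + N * conv f (g ∘ suc) n        ≡⟨ cong₂ _+_ (eq (suc n) 0 (cong suc (ℕ.+-identityʳ n)))
                                             (conv-termwise N p r f f′ (g ∘ suc) (g′ ∘ suc) n
                                               (λ i j i+j≡n → eq i (suc j) (trans (ℕ.+-suc i j) (cong suc i+j≡n)))) ⟩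
  (p * y + r * z) + (p * v + r * w)     ≡⟨ solve 6 (λ p r y z v w → p :* y :+ r :* z :+ (p :* v :+ r :* w)
                                             := p :* (y :+ v) :+ r :* (z :+ w)) refl p r y z v w ⟩
  p * (y + v) + r * (z + w)             ∎
  where
  x = f (suc n) * g 0
  y = f′ (suc n) * g 0
  z = f′ (suc n) * g′ 0
  v = conv f′ (g ∘ suc) n
  w = conv f′ (g′ ∘ suc) n

module Coefficients (a b : ℚ) where

  binomial : ℕ → ℕ → ℚ
  binomial α i = fromℕ (α C i) * a ^ℕ i

  -- The coefficients of (1 - b s)^-(β+1). The exponent exceeds the parameter by one so that the
  -- binomial is free of subtraction.
  negBinomial : ℕ → ℕ → ℚ
  negBinomial β j = fromℕ ((β ℕ.+ j) C j) * b ^ℕ j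

  -- The coefficient of sⁿ in (1 + a s)^α / (1 - b s)^(β + 1).
  D : ℕ → ℕ → ℕ → ℚ
  D α β = conv (binomial α) (negBinomial β)

  binomial-suc : ∀ α n → binomial (suc α) n ≡ binomial α n + a * shift (binomial α) n
  binomial-suc α zero    = sym (trans (cong (binomial α 0 +_) (*-zeroʳ a)) (+-identityʳ _))
  binomial-suc α (suc n) = begin
    fromℕ (suc α C suc n) * (a * x)           ≡⟨ cong (λ c → fromℕ c * (a * x)) (nCk+nC[k+1]≡[n+1]C[k+1] α n) ⟨
    fromℕ ((α C n) ℕ.+ (α C suc n)) * (a * x) ≡⟨ cong (_* (a * x)) (fromℕ-+ (α C n) (α C suc n)) ⟩
    (c + d) * (a * x)                         ≡⟨ solve 4 (λ a c d x → (c :+ d) :* (a :* x) := d :* (a :* x) :+ a :* (c :* x)) refl a c d x ⟩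
    d * (a * x) + a * (c * x)                 ∎
    where
    x = a ^ℕ n
    c = fromℕ (α C n)
    d = fromℕ (α C suc n)

  -- This is 1 = Y + b s divided by Y^(β+2), where Y = 1 - b s; on coefficients it is Pascal's rule.
  negBinomial-suc : ∀ β n → negBinomial (suc β) n ≡ negBinomial β n + b * shift (negBinomial (suc β)) n
  negBinomial-suc β zero    = sym (trans (cong (negBinomial β 0 +_) (*-zeroʳ b)) (+-identityʳ _))
  negBinomial-suc β (suc n) = begin
    fromℕ ((suc β ℕ.+ suc n) C suc n) * (b * x)   ≡⟨ cong (λ c → fromℕ c * (b * x)) pascal ⟩
    fromℕ (c ℕ.+ d) * (b * x)                     ≡⟨ cong (_* (b * x)) (fromℕ-+ c d) ⟩
    (fromℕ c + fromℕ d) * (b * x)                 ≡⟨ solve 4 (λ b c d x → (c :+ d) :* (b :* x) := d :* (b :* x) :+ b :* (c :* x)) refl b (fromℕ c) (fromℕ d) x ⟩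
    fromℕ d * (b * x) + b * (fromℕ c * x)         ∎
    where
    x = b ^ℕ n
    c = (suc β ℕ.+ n) C n
    d = (β ℕ.+ suc n) C suc n
    pascal : (suc β ℕ.+ suc n) C suc n ≡ c ℕ.+ d
    pascal = trans (sym (nCk+nC[k+1]≡[n+1]C[k+1] (β ℕ.+ suc n) n))
      (cong (λ e → (e C n) ℕ.+ d) (ℕ.+-suc β n))

  D-sucˡ : ∀ α β n → D (suc α) β n ≡ D α β n + a * shift (D α β) n
  D-sucˡ α β n = begin
    D (suc α) β n
      ≡⟨ conv-cong (binomial-suc α) (λ _ → refl) n ⟩
    conv (λ i → binomial α i + a * shift (binomial α) i) (negBinomial β) n
      ≡⟨ conv-linearˡ a (binomial α) (shift (binomial α)) (negBinomial β) n ⟩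
    D α β n + a * conv (shift (binomial α)) (negBinomial β) n
      ≡⟨ cong (λ x → D α β n + a * x) (conv-shiftˡ (binomial α) (negBinomial β) n) ⟩
    D α β n + a * shift (D α β) n ∎

  D-sucʳ : ∀ α β n → D α (suc β) n ≡ D α β n + b * shift (D α (suc β)) n
  D-sucʳ α β n = begin
    D α (suc β) n
      ≡⟨ conv-cong (λ _ → refl) (negBinomial-suc β) n ⟩
    conv (binomial α) (λ j → negBinomial β j + b * shift (negBinomial (suc β)) j) n
      ≡⟨ conv-linearʳ b (binomial α) (negBinomial β) (shift (negBinomial (suc β))) n ⟩
    D α β n + b * conv (binomial α) (shift (negBinomial (suc β))) n
      ≡⟨ cong (λ x → D α β n + b * x) (conv-shiftʳ (binomial α) (negBinomial (suc β)) n) ⟩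
    D α β n + b * shift (D α (suc β)) n ∎

  -- From X = Y² + b s X + (a + b) s Y, where X = 1 + a s and Y = 1 - b s.
  D-sucˡʳ : ∀ α β n → D (suc α) (suc (suc β)) n
    ≡ D α β n + b * shift (D (suc α) (suc (suc β))) n + (a + b) * shift (D α (suc β)) n
  D-sucˡʳ α β n = begin
    D (suc α) (suc (suc β)) n
      ≡⟨ D-sucʳ (suc α) (suc β) n ⟩
    D (suc α) (suc β) n + b * x
      ≡⟨ cong (_+ b * x) (D-sucˡ α (suc β) n) ⟩
    D α (suc β) n + a * y + b * x
      ≡⟨ cong (λ z → z + a * y + b * x) (D-sucʳ α β n) ⟩
    D α β n + b * y + a * y + b * x
      ≡⟨ solve 5 (λ a b d x y → d :+ b :* y :+ a :* y :+ b :* x := d :+ b :* x :+ (a :+ b) :* y) refl a b (D α β n) x y ⟩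
    D α β n + b * x + (a + b) * y ∎
    where
    x = shift (D (suc α) (suc (suc β))) n
    y = shift (D α (suc β)) n

  -- The coefficient of sⁿ in φ^M (φ - s φ′) / (1 - b s)^q,
  -- where φ = (1 + a s) / (1 - b s)² and β = 2 M + 1 + q.
  E : ℕ → ℕ → ℕ → ℚ
  E M β n = D M β n - (b + b) * shift (D (suc M) (suc β)) n

  -- `shift` computes only at a constructor, so its linearity is proved by cases here and in the
  -- next two lemmas.
  E-shift : ∀ M β n → shift (E M β) n
    ≡ shift (D M β) n - (b + b) * shift (shift (D (suc M) (suc β))) n
  E-shift M β zero    = solve 1 (λ b → con 0ℚ := con 0ℚ :- (b :+ b) :* con 0ℚ) refl b
  E-shift M β (suc n) = refl

  shift-linear₁ : ∀ {f g h} c → (∀ n → f n ≡ g n + c * shift h n) →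
    ∀ n → shift f n ≡ shift g n + c * shift (shift h) n
  shift-linear₁ c eq zero    = solve 1 (λ c → con 0ℚ := con 0ℚ :+ c :* con 0ℚ) refl c
  shift-linear₁ c eq (suc n) = eq n

  shift-linear₂ : ∀ {f g h k} c d → (∀ n → f n ≡ g n + c * shift h n + d * shift k n) →
    ∀ n → shift f n ≡ shift g n + c * shift (shift h) n + d * shift (shift k) n
  shift-linear₂ c d eq zero    =
    solve 2 (λ c d → con 0ℚ := con 0ℚ :+ c :* con 0ℚ :+ d :* con 0ℚ) refl c d
  shift-linear₂ c d eq (suc n) = eq n

  -- Since φ - s φ′ = 1/Y² - 2 b s X/Y³, `E` is a linear combination of two `D`s whose parameters
  -- differ by one, and a recurrence valid for all parameters of `D` passes to `E`. For b = ℓ this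
  -- one matches a large first parent.
  E-sucʳ : ∀ M β n → E M (suc β) n ≡ E M β n + b * shift (E M (suc β)) n
  E-sucʳ M β n = begin
    D M (suc β) n - (b + b) * shift (D (suc M) (suc (suc β))) n
      ≡⟨ cong₂ (λ x y → x - (b + b) * y) (D-sucʳ M β n) (shift-linear₁ b (D-sucʳ (suc M) (suc β)) n) ⟩
    (x + b * x′) - (b + b) * (y + b * y′)
      ≡⟨ solve 5 (λ b x x′ y y′ → (x :+ b :* x′) :- (b :+ b) :* (y :+ b :* y′)
           := (x :- (b :+ b) :* y) :+ b :* (x′ :- (b :+ b) :* y′)) refl b x x′ y y′ ⟩
    (x - (b + b) * y) + b * (x′ - (b + b) * y′)
      ≡⟨ cong (λ z → E M β n + b * z) (E-shift M (suc β) n) ⟨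
    E M β n + b * shift (E M (suc β)) n ∎
    where
    x = D M β n
    x′ = shift (D M (suc β)) n
    y = shift (D (suc M) (suc β)) n
    y′ = shift (shift (D (suc M) (suc (suc β)))) n

  -- The same transfer, from `D-sucˡʳ`. For b = ℓ and a + b = m it matches a small first parent.
  E-sucˡʳ : ∀ M β n → E (suc M) (suc (suc β)) n
    ≡ E M β n + b * shift (E (suc M) (suc (suc β))) n + (a + b) * shift (E M (suc β)) n
  E-sucˡʳ M β n = begin
    D (suc M) (suc (suc β)) n - (b + b) * shift (D (suc (suc M)) (suc (suc (suc β)))) n
      ≡⟨ cong₂ (λ x y → x - (b + b) * y) (D-sucˡʳ M β n) (shift-linear₂ b (a + b) (D-sucˡʳ (suc M) (suc β)) n) ⟩
    (x + b * x′ + (a + b) * x″) - (b + b) * (y + b * y′ + (a + b) * y″)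
      ≡⟨ solve 8 (λ b c x x′ x″ y y′ y″ → (x :+ b :* x′ :+ c :* x″) :- (b :+ b) :* (y :+ b :* y′ :+ c :* y″)
           := (x :- (b :+ b) :* y) :+ b :* (x′ :- (b :+ b) :* y′) :+ c :* (x″ :- (b :+ b) :* y″)) refl
           b (a + b) x x′ x″ y y′ y″ ⟩
    (x - (b + b) * y) + b * (x′ - (b + b) * y′) + (a + b) * (x″ - (b + b) * y″)
      ≡⟨ cong₂ (λ z w → E M β n + b * z + (a + b) * w) (E-shift (suc M) (suc (suc β)) n) (E-shift M (suc β) n) ⟨
    E M β n + b * shift (E (suc M) (suc (suc β))) n + (a + b) * shift (E M (suc β)) n ∎
    where
    x = D M β n
    x′ = shift (D (suc M) (suc (suc β))) n
    x″ = shift (D M (suc β)) n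
    y = shift (D (suc M) (suc β)) n
    y′ = shift (shift (D (suc (suc M)) (suc (suc (suc β))))) n
    y″ = shift (shift (D (suc M) (suc (suc β)))) n

  E-zero : ∀ M β → E M β 0 ≡ 1ℚ
  E-zero M β = trans (cong (λ x → 1ℚ - x) (*-zeroʳ (b + b))) refl

  -- With N = M + 1, N C(M, i) = (N - i) C(N, i), and N - i = j + p when i + j = n. The part p gives
  -- the first summand; the factor j differentiates the negative power and gives the second.
  D-weighted : ∀ M β n p → n ℕ.+ p ≡ suc M →
    fromℕ (suc M) * D M β n
      ≡ fromℕ p * D (suc M) β n + fromℕ (suc β) * b * shift (D (suc M) (suc β)) n
  D-weighted M β n p n+p≡N = trans
    (conv-termwise (fromℕ (suc M)) (fromℕ p) (fromℕ (suc β) * b) (binomial M) (binomial (suc M))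
      (negBinomial β) (shift (negBinomial (suc β))) n term)
    (cong (λ x → fromℕ p * D (suc M) β n + fromℕ (suc β) * b * x)
      (conv-shiftʳ (binomial (suc M)) (negBinomial (suc β)) n))
    where
    left : ∀ i k → i ℕ.+ k ≡ suc M → fromℕ (suc M) * binomial M i ≡ fromℕ k * binomial (suc M) i
    left i k eq = begin
      fromℕ (suc M) * (fromℕ (M C i) * a ^ℕ i)   ≡⟨ *-assoc (fromℕ (suc M)) (fromℕ (M C i)) (a ^ℕ i) ⟨
      fromℕ (suc M) * fromℕ (M C i) * a ^ℕ i     ≡⟨ cong (_* a ^ℕ i) (fromℕ-* (suc M) (M C i)) ⟨
      fromℕ (suc M ℕ.* (M C i)) * a ^ℕ i         ≡⟨ cong (λ c → fromℕ c * a ^ℕ i) ([1+n]*nCk≡[1+n-k]*[1+n]Ck M i k eq) ⟩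
      fromℕ (k ℕ.* (suc M C i)) * a ^ℕ i         ≡⟨ cong (_* a ^ℕ i) (fromℕ-* k (suc M C i)) ⟩
      fromℕ k * fromℕ (suc M C i) * a ^ℕ i       ≡⟨ *-assoc (fromℕ k) (fromℕ (suc M C i)) (a ^ℕ i) ⟩
      fromℕ k * (fromℕ (suc M C i) * a ^ℕ i)     ∎
    right : ∀ j → fromℕ j * negBinomial β j ≡ fromℕ (suc β) * b * shift (negBinomial (suc β)) j
    right zero    = trans (*-zeroˡ (negBinomial β 0)) (sym (*-zeroʳ (fromℕ (suc β) * b)))
    right (suc j) = begin
      fromℕ (suc j) * (fromℕ c * (b * x))      ≡⟨ *-assoc (fromℕ (suc j)) (fromℕ c) (b * x) ⟨
      fromℕ (suc j) * fromℕ c * (b * x)        ≡⟨ cong (_* (b * x)) (fromℕ-* (suc j) c) ⟨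
      fromℕ (suc j ℕ.* c) * (b * x)            ≡⟨ cong (λ c → fromℕ c * (b * x)) ([1+j]*[β+1+j]C[1+j]≡[1+β]*[1+β+j]Cj β j) ⟩
      fromℕ (suc β ℕ.* d) * (b * x)            ≡⟨ cong (_* (b * x)) (fromℕ-* (suc β) d) ⟩
      fromℕ (suc β) * fromℕ d * (b * x)        ≡⟨ solve 4 (λ β d b x → β :* d :* (b :* x) := β :* b :* (d :* x)) refl (fromℕ (suc β)) (fromℕ d) b x ⟩
      fromℕ (suc β) * b * (fromℕ d * x)        ∎
      where
      x = b ^ℕ j
      c = (β ℕ.+ suc j) C suc j
      d = (suc β ℕ.+ j) C j
    term : ∀ i j → i ℕ.+ j ≡ n → fromℕ (suc M) * (binomial M i * negBinomial β j)
      ≡ fromℕ p * (binomial (suc M) i * negBinomial β j)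
        + fromℕ (suc β) * b * (binomial (suc M) i * shift (negBinomial (suc β)) j)
    term i j i+j≡n = begin
      fromℕ (suc M) * (binomial M i * g)   ≡⟨ *-assoc (fromℕ (suc M)) (binomial M i) g ⟨
      fromℕ (suc M) * binomial M i * g     ≡⟨ cong (_* g) (left i (j ℕ.+ p) (trans (sym (ℕ.+-assoc i j p)) (trans (cong (ℕ._+ p) i+j≡n) n+p≡N))) ⟩
      fromℕ (j ℕ.+ p) * f * g              ≡⟨ cong (λ c → c * f * g) (fromℕ-+ j p) ⟩
      (fromℕ j + fromℕ p) * f * g          ≡⟨ solve 4 (λ j p f g → (j :+ p) :* f :* g := p :* (f :* g) :+ f :* (j :* g)) refl (fromℕ j) (fromℕ p) f g ⟩
      fromℕ p * (f * g) + f * (fromℕ j * g) ≡⟨ cong (λ x → fromℕ p * (f * g) + f * x) (right j) ⟩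
      fromℕ p * (f * g) + f * (r * h)      ≡⟨ cong (λ x → fromℕ p * (f * g) + x) (solve 3 (λ f r h → f :* (r :* h) := r :* (f :* h)) refl f r h) ⟩
      fromℕ p * (f * g) + r * (f * h)      ∎
      where
      f = binomial (suc M) i
      g = negBinomial β j
      h = shift (negBinomial (suc β)) j
      r = fromℕ (suc β) * b

  -- N [s^N] H φ^M (φ - s φ′) = [s^M] H′ φ^N for N = M + 1 and H = s^p / (1 - b s)^q.
  lagrange : ∀ M q n p → n ℕ.+ p ≡ suc M → let β = M ℕ.+ suc M ℕ.+ q in
    fromℕ (suc M) * E M β n
      ≡ fromℕ p * D (suc M) β n + fromℕ q * (b * shift (D (suc M) (suc β)) n)
  lagrange M q n p n+p≡N = begin
    N * (D M β n - (b + b) * y)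
      ≡⟨ solve 4 (λ N d b y → N :* (d :- (b :+ b) :* y) := N :* d :- (N :+ N) :* b :* y) refl N (D M β n) b y ⟩
    N * D M β n - (N + N) * b * y
      ≡⟨ cong (_- (N + N) * b * y) (D-weighted M β n p n+p≡N) ⟩
    -- Here β + 1 = 2 N + q, and the 2 N cancels against the subtracted term of `E`.
    fromℕ p * x + fromℕ (suc M ℕ.+ suc M ℕ.+ q) * b * y - (N + N) * b * y
      ≡⟨ cong (λ c → fromℕ p * x + c * b * y - (N + N) * b * y)
           (trans (fromℕ-+ (suc M ℕ.+ suc M) q) (cong (_+ fromℕ q) (fromℕ-+ (suc M) (suc M)))) ⟩
    fromℕ p * x + (N + N + fromℕ q) * b * y - (N + N) * b * y
      ≡⟨ solve 6 (λ N p q b x y → p :* x :+ (N :+ N :+ q) :* b :* y :- (N :+ N) :* b :* y := p :* x :+ q :* (b :* y)) refl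
           N (fromℕ p) (fromℕ q) b x y ⟩
    fromℕ p * x + fromℕ q * (b * y) ∎
    where
    β = M ℕ.+ suc M ℕ.+ q
    N = fromℕ (suc M)
    x = D (suc M) β n
    y = shift (D (suc M) (suc β)) n

-- The closed formulas

-- Stating the hypothesis at `suc k` lets `k ∸ 1` in the summands reduce.
∑-cong : ∀ n {f g} → (∀ k → suc k ≤ n → f (suc k) ≡ g (suc k)) → ∑[1⋯ n ] f ≡ ∑[1⋯ n ] g
∑-cong zero    eq = refl
∑-cong (suc n) eq = cong₂ _+_ (∑-cong n (λ k k<n → eq k (ℕ.m≤n⇒m≤1+n k<n))) (eq n ℕ.≤-refl)

∑-head : ∀ n f → ∑[1⋯ suc n ] f ≡ f 1 + ∑[1⋯ n ] (f ∘ suc)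
∑-head zero    f = +-comm 0ℚ (f 1)
∑-head (suc n) f = trans (cong (_+ f (2+ n)) (∑-head n f)) (+-assoc (f 1) _ _)

∑-*ˡ : ∀ c n f → c * ∑[1⋯ n ] f ≡ ∑[1⋯ n ] (λ k → c * f k)
∑-*ˡ c zero    f = *-zeroʳ c
∑-*ˡ c (suc n) f = trans (*-distribˡ-+ c _ (f (suc n))) (cong (_+ c * f (suc n)) (∑-*ˡ c n f))

∑-+ : ∀ n f g → ∑[1⋯ n ] (λ k → f k + g k) ≡ ∑[1⋯ n ] f + ∑[1⋯ n ] g
∑-+ zero    f g = refl
∑-+ (suc n) f g = trans (cong (_+ (f (suc n) + g (suc n))) (∑-+ n f g))
  (solve 4 (λ x y z w → x :+ y :+ (z :+ w) := x :+ z :+ (y :+ w)) refl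
    (∑[1⋯ n ] f) (∑[1⋯ n ] g) (f (suc n)) (g (suc n)))

-- The summation index is one more than the index of the second factor, as in the stated sums.
conv-∑ : ∀ f g n → conv f g n ≡ ∑[1⋯ suc n ] (λ k → f (suc n ∸ k) * g (k ∸ 1))
conv-∑ f g zero    = sym (+-identityˡ _)
conv-∑ f g (suc n) = begin
  f (suc n) * g 0 + conv f (g ∘ suc) n
    ≡⟨ cong (f (suc n) * g 0 +_) (conv-∑ f (g ∘ suc) n) ⟩
  f (suc n) * g 0 + ∑[1⋯ suc n ] (λ k → f (suc n ∸ k) * g (suc (k ∸ 1)))
    -- `suc (k ∸ 1)` is `k` because the sum starts at 1.
    ≡⟨ cong (f (suc n) * g 0 +_) (∑-cong (suc n) (λ _ _ → refl)) ⟩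
  f (suc n) * g 0 + ∑[1⋯ suc n ] (λ k → f (suc n ∸ k) * g k)
    ≡⟨ ∑-head (suc n) (λ k → f (suc (suc n) ∸ k) * g (k ∸ 1)) ⟨
  ∑[1⋯ suc (suc n) ] (λ k → f (suc (suc n) ∸ k) * g (k ∸ 1)) ∎

-- Forest counts as coefficients

module _ (ℓ m : ℕ) where

  open Coefficients (m-ℓ ℓ m) (fromℕ ℓ)

  m-ℓ+ℓ≡m : m-ℓ ℓ m + fromℕ ℓ ≡ fromℕ m
  m-ℓ+ℓ≡m = trans (cong (_+ fromℕ ℓ) (fromℤ-- (ℤ.+ m) (ℤ.+ ℓ)))
    (solve 2 (λ m ℓ → m :- ℓ :+ ℓ := m) refl (fromℕ m) (fromℕ ℓ))

  smalls larges : List Bool → ℕ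
  smalls []           = 0
  smalls (false ∷ bs) = suc (smalls bs)
  smalls (true ∷ bs)  = smalls bs
  larges []           = 0
  larges (false ∷ bs) = larges bs
  larges (true ∷ bs)  = suc (larges bs)

  -- Lagrange inversion for H = 1, that is p = q = 0: the right side vanishes, and the factor
  -- `suc n` can be divided out.
  E-boundary : ∀ n → E n (n ℕ.+ suc n ℕ.+ 0) (suc n) ≡ 0ℚ
  E-boundary n = trans
    (*-solve x (suc n) 0ℚ (begin
      fromℕ (suc n) * x   ≡⟨ lagrange n 0 (suc n) 0 (ℕ.+-identityʳ (suc n)) ⟩
      0ℚ * y + 0ℚ * z     ≡⟨ cong₂ _+_ (*-zeroˡ y) (*-zeroˡ z) ⟩
      0ℚ                  ∎))
    (*-zeroʳ (ℤ.+ 1 / suc n))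
    where
    x = E n (n ℕ.+ suc n ℕ.+ 0) (suc n)
    y = D (suc n) (n ℕ.+ suc n ℕ.+ 0) (suc n)
    z = fromℕ ℓ * D (suc n) (suc (n ℕ.+ suc n ℕ.+ 0)) n

  -- Induction along `forestCount`. The equation encodes M = n + p - 1 without subtraction. It stays
  -- solvable at weight 0, since every call at lower weight has a small parent.
  forestCount≡E : ∀ n bs M → n ℕ.+ smalls bs ≡ suc M →
    fromℕ (forestCount ℓ m n bs) ≡ E M (M ℕ.+ suc M ℕ.+ larges bs) n
  forestCount≡E zero    bs M eq = sym (E-zero M (M ℕ.+ suc M ℕ.+ larges bs))
  forestCount≡E (suc n) [] M eq =
    subst (λ M → 0ℚ ≡ E M (M ℕ.+ suc M ℕ.+ 0) (suc n))
      (trans (sym (ℕ.+-identityʳ n)) (ℕ.suc-injective eq)) (sym (E-boundary n))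
  forestCount≡E (suc n) (false ∷ bs) M eq =
    -- The equation forces M = `suc M′`, which exposes the successor in `E-sucˡʳ`.
    subst (λ M → fromℕ (c ℕ.+ (ℓ ℕ.* c₁ ℕ.+ m ℕ.* c₂)) ≡ E M (M ℕ.+ suc M ℕ.+ larges bs) (suc n))
    (trans (sym (ℕ.+-suc n (smalls bs))) (ℕ.suc-injective eq)) (begin
    fromℕ (c ℕ.+ (ℓ ℕ.* c₁ ℕ.+ m ℕ.* c₂))
      ≡⟨ fromℕ-+ c _ ⟩
    fromℕ c + fromℕ (ℓ ℕ.* c₁ ℕ.+ m ℕ.* c₂)
      ≡⟨ cong (fromℕ c +_) (trans (fromℕ-+ (ℓ ℕ.* c₁) (m ℕ.* c₂)) (cong₂ _+_ (fromℕ-* ℓ c₁) (fromℕ-* m c₂))) ⟩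
    fromℕ c + (fromℕ ℓ * fromℕ c₁ + fromℕ m * fromℕ c₂)
      ≡⟨ +-assoc (fromℕ c) (fromℕ ℓ * fromℕ c₁) (fromℕ m * fromℕ c₂) ⟨
    fromℕ c + fromℕ ℓ * fromℕ c₁ + fromℕ m * fromℕ c₂
      -- Dropping the small parent lowers M by 1 and β by 2. A small child trades a unit of weight
      -- for a small parent, so M and β stay. A large child lowers M by 1 but raises q by 1, so β
      -- drops by 1.
      ≡⟨ cong₂ (λ x y → x + fromℕ ℓ * y + fromℕ m * fromℕ c₂)
           (forestCount≡E (suc n) bs M′ refl)
           (trans (forestCount≡E n (false ∷ false ∷ bs) (suc M′) (trans (ℕ.+-suc n (suc (smalls bs))) (cong suc (ℕ.+-suc n (smalls bs)))))
             (cong (λ β → E (suc M′) β n) β-eq)) ⟩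
    E M′ β (suc n) + fromℕ ℓ * E (suc M′) (suc (suc β)) n + fromℕ m * fromℕ c₂
      ≡⟨ cong₂ (λ x y → E M′ β (suc n) + fromℕ ℓ * E (suc M′) (suc (suc β)) n + x * y)
           (sym m-ℓ+ℓ≡m)
           (trans (forestCount≡E n (true ∷ false ∷ bs) M′ (ℕ.+-suc n (smalls bs)))
             (cong (λ β → E M′ β n) (ℕ.+-suc (M′ ℕ.+ suc M′) (larges bs)))) ⟩
    E M′ β (suc n) + fromℕ ℓ * E (suc M′) (suc (suc β)) n + (m-ℓ ℓ m + fromℕ ℓ) * E M′ (suc β) n
      ≡⟨ E-sucˡʳ M′ β (suc n) ⟨
    E (suc M′) (suc (suc β)) (suc n)
      ≡⟨ cong (λ β → E (suc M′) β (suc n)) β-eq ⟨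
    E (suc M′) (suc M′ ℕ.+ suc (suc M′) ℕ.+ larges bs) (suc n) ∎)
    where
    M′ = n ℕ.+ smalls bs
    β  = M′ ℕ.+ suc M′ ℕ.+ larges bs
    c  = forestCount ℓ m (suc n) bs
    c₁ = forestCount ℓ m n (false ∷ false ∷ bs)
    c₂ = forestCount ℓ m n (true ∷ false ∷ bs)
    β-eq : suc M′ ℕ.+ suc (suc M′) ℕ.+ larges bs ≡ suc (suc β)
    β-eq = cong (λ x → suc (x ℕ.+ larges bs)) (ℕ.+-suc M′ (suc M′))
  forestCount≡E (suc n) (true ∷ bs) M eq = begin
    fromℕ (c ℕ.+ (ℓ ℕ.* c₁ ℕ.+ m ℕ.* 0))
      ≡⟨ cong (λ x → fromℕ (c ℕ.+ x)) (trans (cong (ℓ ℕ.* c₁ ℕ.+_) (ℕ.*-zeroʳ m)) (ℕ.+-identityʳ _)) ⟩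
    fromℕ (c ℕ.+ ℓ ℕ.* c₁)
      ≡⟨ trans (fromℕ-+ c (ℓ ℕ.* c₁)) (cong (fromℕ c +_) (fromℕ-* ℓ c₁)) ⟩
    fromℕ c + fromℕ ℓ * fromℕ c₁
      ≡⟨ cong₂ (λ x y → x + fromℕ ℓ * y)
           (forestCount≡E (suc n) bs M eq)
           (trans (forestCount≡E n (false ∷ true ∷ bs) M (trans (ℕ.+-suc n (smalls bs)) eq))
             (cong (λ β → E M β n) β-eq)) ⟩
    E M β (suc n) + fromℕ ℓ * E M (suc β) n
      ≡⟨ E-sucʳ M β (suc n) ⟨
    E M (suc β) (suc n)
      ≡⟨ cong (λ β → E M β (suc n)) β-eq ⟨
    E M (M ℕ.+ suc M ℕ.+ suc (larges bs)) (suc n) ∎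
    where
    β  = M ℕ.+ suc M ℕ.+ larges bs
    c  = forestCount ℓ m (suc n) bs
    c₁ = forestCount ℓ m n (false ∷ true ∷ bs)
    β-eq : M ℕ.+ suc M ℕ.+ suc (larges bs) ≡ suc β
    β-eq = ℕ.+-suc (M ℕ.+ suc M) (larges bs)

  -- Trees with a fixed root color

  smallTerm : ℕ → ℕ → ℚ
  smallTerm n k = m-ℓ ℓ m ^ℕ (n ∸ k) * fromℕ ℓ ^ℕ (k ∸ 1)
    * fromℕ (n C k) * fromℕ (binom[2n+k-2,k-1] n k)

  largeTerm : ℕ → ℕ → ℚ
  largeTerm n k = m-ℓ ℓ m ^ℕ (n ∸ k ∸ 1) * fromℕ ℓ ^ℕ k
    * fromℕ ((n ∸ 1) C k) * fromℕ (binom[2n+k-2,k-1] n k)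

  -- The case p = 1, q = 0 of `lagrange`: only the first summand survives, leaving the coefficient
  -- of sⁿ in φ^(n+1).
  smallRoot-count : ∀ n → fromℕ (forestCount ℓ m n (false ∷ [])) ≡ smallRootFormula ℓ m (suc n)
  smallRoot-count n = *-solve (fromℕ (forestCount ℓ m n (false ∷ []))) (suc n) _ (begin
    fromℕ (suc n) * fromℕ (forestCount ℓ m n (false ∷ []))
      ≡⟨ cong (fromℕ (suc n) *_) (forestCount≡E n (false ∷ []) n (ℕ.+-comm n 1)) ⟩
    fromℕ (suc n) * E n β n
      ≡⟨ lagrange n 0 n 1 (ℕ.+-comm n 1) ⟩
    1ℚ * D (suc n) β n + 0ℚ * x
      ≡⟨ cong₂ _+_ (*-identityˡ (D (suc n) β n)) (*-zeroˡ x) ⟩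
    D (suc n) β n + 0ℚ
      ≡⟨ +-identityʳ (D (suc n) β n) ⟩
    D (suc n) β n
      ≡⟨ conv-∑ (binomial (suc n)) (negBinomial β) n ⟩
    ∑[1⋯ suc n ] (λ k → binomial (suc n) (suc n ∸ k) * negBinomial β (k ∸ 1))
      ≡⟨ ∑-cong (suc n) term ⟩
    ∑[1⋯ suc n ] (smallTerm (suc n)) ∎)
    where
    β = n ℕ.+ suc n ℕ.+ 0
    x = fromℕ ℓ * shift (D (suc n) (suc β)) n
    top : ∀ k → β ℕ.+ k ≡ 2 ℕ.* suc n ℕ.+ suc k ∸ 2
    top k = begin
      n ℕ.+ suc n ℕ.+ 0 ℕ.+ k         ≡⟨ cong (ℕ._+ k) (ℕ.+-assoc n (suc n) 0) ⟩
      n ℕ.+ (suc n ℕ.+ 0) ℕ.+ k       ≡⟨ cong (_∸ 1) (ℕ.+-suc (n ℕ.+ (suc n ℕ.+ 0)) k) ⟨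
      n ℕ.+ (suc n ℕ.+ 0) ℕ.+ suc k ∸ 1 ∎
    term : ∀ k → suc k ≤ suc n →
      binomial (suc n) (suc n ∸ suc k) * negBinomial β k ≡ smallTerm (suc n) (suc k)
    term k k<n = trans
      (cong₂ (λ c d → fromℕ c * u * (fromℕ d * v)) (sym (nCk≡nC[n∸k] k<n)) (cong (_C k) (top k)))
      (solve 4 (λ u v c d → c :* u :* (d :* v) := u :* v :* c :* d) refl u v
        (fromℕ (suc n C suc k)) (fromℕ (binom[2n+k-2,k-1] (suc n) (suc k))))
      where
      u = m-ℓ ℓ m ^ℕ (n ∸ k)
      v = fromℕ ℓ ^ℕ k

  -- The case p = 0, q = 1 at weight `suc n`: only the second summand survives. Its factor b = ℓ
  -- raises the power of ℓ from k - 1 to k.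
  largeRoot-count : ∀ n → fromℕ (forestCount ℓ m (suc n) (true ∷ [])) ≡ largeRootFormula ℓ m (2+ n)
  largeRoot-count n = *-solve (fromℕ (forestCount ℓ m (suc n) (true ∷ []))) (suc n) _ (begin
    fromℕ (suc n) * fromℕ (forestCount ℓ m (suc n) (true ∷ []))
      ≡⟨ cong (fromℕ (suc n) *_) (forestCount≡E (suc n) (true ∷ []) n (ℕ.+-identityʳ (suc n))) ⟩
    fromℕ (suc n) * E n β (suc n)
      ≡⟨ lagrange n 1 (suc n) 0 (ℕ.+-identityʳ (suc n)) ⟩
    0ℚ * x + 1ℚ * (fromℕ ℓ * D (suc n) (suc β) n)
      ≡⟨ cong₂ _+_ (*-zeroˡ x) (*-identityˡ (fromℕ ℓ * D (suc n) (suc β) n)) ⟩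
    0ℚ + fromℕ ℓ * D (suc n) (suc β) n
      ≡⟨ +-identityˡ (fromℕ ℓ * D (suc n) (suc β) n) ⟩
    fromℕ ℓ * D (suc n) (suc β) n
      ≡⟨ cong (fromℕ ℓ *_) (conv-∑ (binomial (suc n)) (negBinomial (suc β)) n) ⟩
    fromℕ ℓ * ∑[1⋯ suc n ] (λ k → binomial (suc n) (suc n ∸ k) * negBinomial (suc β) (k ∸ 1))
      ≡⟨ ∑-*ˡ (fromℕ ℓ) (suc n) _ ⟩
    ∑[1⋯ suc n ] (λ k → fromℕ ℓ * (binomial (suc n) (suc n ∸ k) * negBinomial (suc β) (k ∸ 1)))
      ≡⟨ ∑-cong (suc n) term ⟩
    ∑[1⋯ suc n ] (largeTerm (2+ n)) ∎)
    where
    β = n ℕ.+ suc n ℕ.+ 1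
    x = D (suc n) β (suc n)
    top : ∀ k → suc β ℕ.+ k ≡ 2 ℕ.* 2+ n ℕ.+ suc k ∸ 2
    top k = begin
      suc (n ℕ.+ suc n ℕ.+ 1 ℕ.+ k)  ≡⟨ cong suc (ℕ.+-assoc (n ℕ.+ suc n) 1 k) ⟩
      suc (n ℕ.+ suc n) ℕ.+ suc k    ≡⟨ cong (ℕ._+ suc k) (ℕ.+-suc n (suc n)) ⟨
      n ℕ.+ 2+ n ℕ.+ suc k           ≡⟨ cong (λ x → n ℕ.+ x ℕ.+ suc k) (ℕ.+-identityʳ (2+ n)) ⟨
      n ℕ.+ (2+ n ℕ.+ 0) ℕ.+ suc k   ∎
    term : ∀ k → suc k ≤ suc n →
      fromℕ ℓ * (binomial (suc n) (suc n ∸ suc k) * negBinomial (suc β) k) ≡ largeTerm (2+ n) (suc k)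
    term k k<n = begin
      fromℕ ℓ * (fromℕ (suc n C (n ∸ k)) * u * (fromℕ ((suc β ℕ.+ k) C k) * v))
        ≡⟨ cong₂ (λ c d → fromℕ ℓ * (fromℕ c * u * (fromℕ d * v)))
             (sym (nCk≡nC[n∸k] k<n)) (cong (_C k) (top k)) ⟩
      fromℕ ℓ * (fromℕ c * u * (fromℕ d * v))
        ≡⟨ solve 5 (λ u v c d ℓ → ℓ :* (c :* u :* (d :* v)) := u :* (ℓ :* v) :* c :* d) refl u v (fromℕ c) (fromℕ d) (fromℕ ℓ) ⟩
      u * (fromℕ ℓ * v) * fromℕ c * fromℕ d
        ≡⟨ cong (λ e → m-ℓ ℓ m ^ℕ e * (fromℕ ℓ * v) * fromℕ c * fromℕ d) (cong (_∸ 1) (ℕ.+-∸-assoc 1 (ℕ.≤-pred k<n))) ⟨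
      largeTerm (2+ n) (suc k) ∎
      where
      u = m-ℓ ℓ m ^ℕ (n ∸ k)
      v = fromℕ ℓ ^ℕ k
      c = suc n C suc k
      d = binom[2n+k-2,k-1] (2+ n) (suc k)

  -- Trees with an arbitrary root color

  fromℤ-totalNumerator : ∀ n k → fromℤ (totalNumerator ℓ m n k)
    ≡ (fromℕ 2 * fromℕ m - fromℕ ℓ) * fromℕ n - fromℕ m * fromℕ k + (fromℕ ℓ - fromℕ m)
  fromℤ-totalNumerator n k = begin
    fromℤ (x ℤ.* n′ ℤ.- m′ ℤ.* k′ ℤ.+ (ℓ′ ℤ.- m′))
      ≡⟨ fromℤ-+ (x ℤ.* n′ ℤ.- m′ ℤ.* k′) (ℓ′ ℤ.- m′) ⟩
    fromℤ (x ℤ.* n′ ℤ.- m′ ℤ.* k′) + fromℤ (ℓ′ ℤ.- m′)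
      ≡⟨ cong₂ _+_ (fromℤ-- (x ℤ.* n′) (m′ ℤ.* k′)) (fromℤ-- ℓ′ m′) ⟩
    fromℤ (x ℤ.* n′) - fromℤ (m′ ℤ.* k′) + (fromℕ ℓ - fromℕ m)
      ≡⟨ cong₂ (λ y z → y - z + (fromℕ ℓ - fromℕ m)) (fromℤ-* x n′) (fromℤ-* m′ k′) ⟩
    fromℤ x * fromℕ n - fromℕ m * fromℕ k + (fromℕ ℓ - fromℕ m)
      ≡⟨ cong (λ y → y * fromℕ n - fromℕ m * fromℕ k + (fromℕ ℓ - fromℕ m))
           (trans (fromℤ-- (ℤ.+ 2 ℤ.* m′) ℓ′) (cong (_- fromℕ ℓ) (fromℤ-* (ℤ.+ 2) m′))) ⟩
    (fromℕ 2 * fromℕ m - fromℕ ℓ) * fromℕ n - fromℕ m * fromℕ k + (fromℕ ℓ - fromℕ m) ∎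
    where
    ℓ′ = ℤ.+ ℓ
    m′ = ℤ.+ m
    n′ = ℤ.+ n
    k′ = ℤ.+ k
    x = ℤ.+ 2 ℤ.* m′ ℤ.- ℓ′

  module _ (n : ℕ) where

    private
      N = 2+ n
      N⁻¹ = ℤ.+ 1 / N
      [N-1]⁻¹ = ℤ.+ 1 / suc n
      a = m-ℓ ℓ m
      _/N[N-1] : ℤ → ℚ
      i /N[N-1] = ℚ._/_ i (N ℕ.* suc n) {{n*pred-nonZero N}}
      B : ℕ → ℚ
      B k = fromℕ (binom[2n+k-2,k-1] N k)

    -- With r = N - k, the first summand comes from small roots and the second from large ones. At k
    -- = N only the multiple of m - ℓ remains.
    fromℤ-totalNumerator′ : ∀ k r → k ℕ.+ r ≡ N →
      fromℤ (totalNumerator ℓ m N k) ≡ a * fromℕ (suc n) + fromℕ m * fromℕ r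
    fromℤ-totalNumerator′ k r eq = begin
      fromℤ (totalNumerator ℓ m N k)
        ≡⟨ fromℤ-totalNumerator N k ⟩
      (fromℕ 2 * fromℕ m - fromℕ ℓ) * fromℕ N - fromℕ m * fromℕ k + (fromℕ ℓ - fromℕ m)
        ≡⟨ solve 4 (λ m ℓ n k → (con (fromℕ 2) :* m :- ℓ) :* n :- m :* k :+ (ℓ :- m)
             := (m :- ℓ) :* (n :- con 1ℚ) :+ m :* (n :- k)) refl (fromℕ m) (fromℕ ℓ) (fromℕ N) (fromℕ k) ⟩
      (fromℕ m - fromℕ ℓ) * (fromℕ N - 1ℚ) + fromℕ m * (fromℕ N - fromℕ k)
        ≡⟨ cong₂ (λ x y → x * (fromℕ N - 1ℚ) + fromℕ m * (y - fromℕ k))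
             (sym (fromℤ-- (ℤ.+ m) (ℤ.+ ℓ))) (trans (cong fromℕ (sym eq)) (fromℕ-+ k r)) ⟩
      a * (fromℕ N - 1ℚ) + fromℕ m * (fromℕ k + fromℕ r - fromℕ k)
        ≡⟨ cong₂ (λ x y → a * x + fromℕ m * y)
             (trans (cong (_- 1ℚ) (fromℕ-+ 1 (suc n))) (solve 1 (λ x → con 1ℚ :+ x :- con 1ℚ := x) refl (fromℕ (suc n))))
             (solve 2 (λ k r → k :+ r :- k := r) refl (fromℕ k) (fromℕ r)) ⟩
      a * fromℕ (suc n) + fromℕ m * fromℕ r ∎

    /-split : ∀ i → i /N[N-1] ≡ fromℤ i * N⁻¹ * [N-1]⁻¹
    /-split i = begin
      w
        ≡⟨ trans (sym (*-identityʳ w)) (cong (w *_) (sym (*-identityʳ 1ℚ))) ⟩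
      w * (1ℚ * 1ℚ)
        ≡⟨ cong₂ (λ x y → w * (x * y)) (/-*-cancel (ℤ.+ 1) N) (/-*-cancel (ℤ.+ 1) (suc n)) ⟨
      w * (N⁻¹ * fromℕ N * ([N-1]⁻¹ * fromℕ (suc n)))
        ≡⟨ solve 5 (λ w u x v y → w :* (u :* x :* (v :* y)) := w :* (x :* y) :* u :* v) refl
             w N⁻¹ (fromℕ N) [N-1]⁻¹ (fromℕ (suc n)) ⟩
      w * (fromℕ N * fromℕ (suc n)) * N⁻¹ * [N-1]⁻¹
        ≡⟨ cong (λ x → w * x * N⁻¹ * [N-1]⁻¹) (fromℕ-* N (suc n)) ⟨
      w * fromℕ (N ℕ.* suc n) * N⁻¹ * [N-1]⁻¹
        ≡⟨ cong (λ x → x * N⁻¹ * [N-1]⁻¹) (/-*-cancel i (N ℕ.* suc n) {{n*pred-nonZero N}}) ⟩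
      fromℤ i * N⁻¹ * [N-1]⁻¹ ∎
      where
      w = i /N[N-1]

    totalTerm : ℕ → ℚ
    totalTerm k = (totalNumerator ℓ m N k) /N[N-1]
      * a ^ℕ (N ∸ k ∸ 1) * fromℕ ℓ ^ℕ k * fromℕ (N C k) * B k

    lastTerm : ℚ
    lastTerm = (ℤ.+ suc n) /N[N-1]
      * fromℕ ℓ ^ℕ N * fromℕ (N C N) * B N

    -- In the small summand one factor a leaves the power a^(N-k). In the large one, C(N-1, k) = ((N
    -- - k)/N) C(N, k). Over the denominator N (N-1) the numerators add up as in
    -- `fromℤ-totalNumerator′`.
    totalTerm-split : ∀ k → suc k ≤ suc n →
      fromℕ ℓ * (N⁻¹ * smallTerm N (suc k)) + fromℕ m * ([N-1]⁻¹ * largeTerm N (suc k))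
        ≡ totalTerm (suc k)
    totalTerm-split k k<n = begin
      l * (u * (a ^ℕ (suc n ∸ k) * y * c * d)) + fromℕ m * (v * (a ^ℕ (suc n ∸ k ∸ 1) * (l * y) * c′ * d))
        ≡⟨ cong (λ e → l * (u * (a ^ℕ e * y * c * d)) + fromℕ m * (v * (a ^ℕ (e ∸ 1) * (l * y) * c′ * d))) e-eq ⟩
      l * (u * (a * x * y * c * d)) + fromℕ m * (v * (x * (l * y) * c′ * d))
        -- The inserted `1ℚ` is replaced next by `v * s`, which supplies the factor 1/(N-1) missing
        -- from the small summand.
        ≡⟨ cong₂ (λ z w → z + fromℕ m * (v * (x * (l * y) * w * d)))
             (sym (*-identityʳ (l * (u * (a * x * y * c * d))))) c′-eq ⟩
      l * (u * (a * x * y * c * d)) * 1ℚ + fromℕ m * (v * (x * (l * y) * (u * (r * c)) * d))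
        ≡⟨ cong (λ z → l * (u * (a * x * y * c * d)) * z + fromℕ m * (v * (x * (l * y) * (u * (r * c)) * d)))
             (/-*-cancel (ℤ.+ 1) (suc n)) ⟨
      l * (u * (a * x * y * c * d)) * (v * s) + fromℕ m * (v * (x * (l * y) * (u * (r * c)) * d))
        ≡⟨ solve 11 (λ l u v a x y c d s m r →
             l :* (u :* (a :* x :* y :* c :* d)) :* (v :* s) :+ m :* (v :* (x :* (l :* y) :* (u :* (r :* c)) :* d))
             := (a :* s :+ m :* r) :* u :* v :* x :* (l :* y) :* c :* d) refl l u v a x y c d s (fromℕ m) r ⟩
      (a * s + fromℕ m * r) * u * v * x * (l * y) * c * d
        ≡⟨ cong (λ z → z * u * v * x * (l * y) * c * d)
             (fromℤ-totalNumerator′ (suc k) (suc n ∸ k) (cong suc (ℕ.m+[n∸m]≡n k≤sn))) ⟨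
      fromℤ (totalNumerator ℓ m N (suc k)) * u * v * x * (l * y) * c * d
        ≡⟨ cong (λ z → z * x * (l * y) * c * d) (/-split (totalNumerator ℓ m N (suc k))) ⟨
      (totalNumerator ℓ m N (suc k)) /N[N-1] * x * (l * y) * c * d
        ≡⟨ cong (λ e → (totalNumerator ℓ m N (suc k)) /N[N-1]
             * a ^ℕ (e ∸ 1) * (l * y) * c * d) e-eq ⟨
      totalTerm (suc k) ∎
      where
      k≤n = ℕ.≤-pred k<n
      k≤sn = ℕ.m≤n⇒m≤1+n k≤n
      l = fromℕ ℓ
      u = N⁻¹
      v = [N-1]⁻¹
      x = a ^ℕ (n ∸ k)
      y = l ^ℕ k
      c = fromℕ (N C suc k)
      c′ = fromℕ (suc n C suc k)
      d = B (suc k)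
      s = fromℕ (suc n)
      r = fromℕ (suc n ∸ k)
      e-eq : suc n ∸ k ≡ suc (n ∸ k)
      e-eq = ℕ.+-∸-assoc 1 k≤n
      c′-eq : c′ ≡ u * (r * c)
      c′-eq = *-solve c′ N (r * c) (begin
        fromℕ N * c′                            ≡⟨ fromℕ-* N (suc n C suc k) ⟨
        fromℕ (N ℕ.* (suc n C suc k))           ≡⟨ cong fromℕ ([1+n]*nCk≡[1+n-k]*[1+n]Ck (suc n) (suc k) (suc n ∸ k)
                                                     (cong suc (ℕ.m+[n∸m]≡n k≤sn))) ⟩
        fromℕ ((suc n ∸ k) ℕ.* (N C suc k))     ≡⟨ fromℕ-* (suc n ∸ k) (N C suc k) ⟩
        r * c                                   ∎)

    -- The sum for large roots stops at N - 1, so the term k = N comes from small roots alone; its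
    -- power of a is a⁰.
    lastTerm-small : fromℕ ℓ * (N⁻¹ * smallTerm N N) ≡ lastTerm
    lastTerm-small = begin
      l * (N⁻¹ * (a ^ℕ (n ∸ n) * y * c * d))
        ≡⟨ cong (λ e → l * (N⁻¹ * (a ^ℕ e * y * c * d))) (ℕ.n∸n≡0 n) ⟩
      l * (N⁻¹ * (1ℚ * y * c * d))
        ≡⟨ cong (λ z → l * (N⁻¹ * (z * y * c * d))) (/-*-cancel (ℤ.+ 1) (suc n)) ⟨
      l * (N⁻¹ * ([N-1]⁻¹ * s * y * c * d))
        ≡⟨ solve 7 (λ l u v s y c d → l :* (u :* (v :* s :* y :* c :* d)) := s :* u :* v :* (l :* y) :* c :* d) refl
             l N⁻¹ [N-1]⁻¹ s y c d ⟩
      s * N⁻¹ * [N-1]⁻¹ * (l * y) * c * d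
        ≡⟨ cong (λ z → z * (l * y) * c * d) (/-split (ℤ.+ suc n)) ⟨
      lastTerm ∎
      where
      l = fromℕ ℓ
      y = l ^ℕ suc n
      c = fromℕ (N C N)
      d = B N
      s = fromℕ (suc n)

    -- There are ℓ small and m large root colors. The computation never divides by m - ℓ, so it
    -- serves both m ≢ ℓ and m ≡ ℓ.
    total≡cancelled :
      fromℕ (ℓ ℕ.* forestCount ℓ m (suc n) (false ∷ []) ℕ.+ m ℕ.* forestCount ℓ m (suc n) (true ∷ []))
        ≡ totalFormulaCancelled ℓ m N
    total≡cancelled = begin
      fromℕ (ℓ ℕ.* s ℕ.+ m ℕ.* t)
        ≡⟨ trans (fromℕ-+ (ℓ ℕ.* s) (m ℕ.* t)) (cong₂ _+_ (fromℕ-* ℓ s) (fromℕ-* m t)) ⟩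
      fromℕ ℓ * fromℕ s + fromℕ m * fromℕ t
        ≡⟨ cong₂ (λ x y → fromℕ ℓ * x + fromℕ m * y) (smallRoot-count (suc n)) (largeRoot-count n) ⟩
      fromℕ ℓ * (N⁻¹ * (∑S + smallTerm N N)) + fromℕ m * ([N-1]⁻¹ * ∑L)
        ≡⟨ solve 7 (λ l u S x m v L → l :* (u :* (S :+ x)) :+ m :* (v :* L)
             := l :* (u :* S) :+ m :* (v :* L) :+ l :* (u :* x)) refl
             (fromℕ ℓ) N⁻¹ ∑S (smallTerm N N) (fromℕ m) [N-1]⁻¹ ∑L ⟩
      fromℕ ℓ * (N⁻¹ * ∑S) + fromℕ m * ([N-1]⁻¹ * ∑L) + fromℕ ℓ * (N⁻¹ * smallTerm N N)
        ≡⟨ cong₂ (λ x y → x + y + fromℕ ℓ * (N⁻¹ * smallTerm N N))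
             (distribute (fromℕ ℓ) N⁻¹ (smallTerm N)) (distribute (fromℕ m) [N-1]⁻¹ (largeTerm N)) ⟩
      ∑[1⋯ suc n ] (λ k → fromℕ ℓ * (N⁻¹ * smallTerm N k))
        + ∑[1⋯ suc n ] (λ k → fromℕ m * ([N-1]⁻¹ * largeTerm N k)) + fromℕ ℓ * (N⁻¹ * smallTerm N N)
        ≡⟨ cong₂ _+_ (sym (∑-+ (suc n) (λ k → fromℕ ℓ * (N⁻¹ * smallTerm N k))
             (λ k → fromℕ m * ([N-1]⁻¹ * largeTerm N k)))) lastTerm-small ⟩
      ∑[1⋯ suc n ] (λ k → fromℕ ℓ * (N⁻¹ * smallTerm N k) + fromℕ m * ([N-1]⁻¹ * largeTerm N k)) + lastTerm
        ≡⟨ cong (_+ lastTerm) (∑-cong (suc n) totalTerm-split) ⟩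
      ∑[1⋯ suc n ] totalTerm + lastTerm ∎
      where
      s = forestCount ℓ m (suc n) (false ∷ [])
      t = forestCount ℓ m (suc n) (true ∷ [])
      ∑S = ∑[1⋯ suc n ] (smallTerm N)
      ∑L = ∑[1⋯ suc n ] (largeTerm N)
      distribute : ∀ x y f → x * (y * ∑[1⋯ suc n ] f) ≡ ∑[1⋯ suc n ] (λ k → x * (y * f k))
      distribute x y f = trans (cong (x *_) (∑-*ˡ y (suc n) f)) (∑-*ˡ x (suc n) (λ k → y * f k))

    -- Below k = N the integer exponents are nonnegative and agree with the truncated ones; at k = N
    -- the factor a of the numerator meets a⁻¹.
    cancelled≡total : ∀ (m≢ℓ : m ≢ ℓ) → totalFormulaCancelled ℓ m N ≡ totalFormula ℓ m N m≢ℓ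
    cancelled≡total m≢ℓ = cong₂ _+_ (∑-cong (suc n) term) last
      where
      instance
        a≢0 : ℚ.NonZero a
        a≢0 = m-ℓ-nonZero m≢ℓ
      exponent : ∀ k → k ≤ n → ℤ.+ N ℤ.- ℤ.+ suc k ℤ.- ℤ.+ 1 ≡ ℤ.+ (N ∸ suc k ∸ 1)
      exponent k k≤n = begin
        ℤ.+ N ℤ.- ℤ.+ suc k ℤ.- ℤ.+ 1
          ≡⟨ cong (ℤ._- ℤ.+ 1) (trans (ℤ.m-n≡m⊖n N (suc k)) (ℤ.⊖-≥ (s≤s (ℕ.m≤n⇒m≤1+n k≤n)))) ⟩
        ℤ.+ (suc n ∸ k) ℤ.- ℤ.+ 1
          ≡⟨ trans (ℤ.m-n≡m⊖n (suc n ∸ k) 1) (ℤ.⊖-≥ (ℕ.m<n⇒0<n∸m (s≤s k≤n))) ⟩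
        ℤ.+ (suc n ∸ k ∸ 1) ∎
      term : ∀ k → suc k ≤ suc n → totalTerm (suc k)
        ≡ (totalNumerator ℓ m N (suc k)) /N[N-1]
          * a ^ℤ (ℤ.+ N ℤ.- ℤ.+ suc k ℤ.- ℤ.+ 1) * fromℕ ℓ ^ℕ suc k * fromℕ (N C suc k) * B (suc k)
      term k k<n = cong (λ e → (totalNumerator ℓ m N (suc k)) /N[N-1]
          * a ^ℤ e * fromℕ ℓ ^ℕ suc k * fromℕ (N C suc k) * B (suc k)) (sym (exponent k (ℕ.≤-pred k<n)))
      cancel : (ℤ.+ suc n) /N[N-1]
        ≡ (totalNumerator ℓ m N N) /N[N-1] * a ^ℤ (ℤ.+ N ℤ.- ℤ.+ N ℤ.- ℤ.+ 1)
      cancel = begin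
        (ℤ.+ suc n) /N[N-1]
          ≡⟨ /-split (ℤ.+ suc n) ⟩
        s * N⁻¹ * [N-1]⁻¹
          ≡⟨ trans (cong (s * N⁻¹ * [N-1]⁻¹ *_) (*-inverseʳ a)) (*-identityʳ (s * N⁻¹ * [N-1]⁻¹)) ⟨
        s * N⁻¹ * [N-1]⁻¹ * (a * 1/ a)
          -- The zero summand gives the shape of `fromℤ-totalNumerator′` at r = 0, and `1/ a * 1ℚ`
          -- is what `a ^ℤ -[1+ 0 ]` unfolds to.
          ≡⟨ solve 6 (λ s u v a a′ m → s :* u :* v :* (a :* a′)
               := (a :* s :+ m :* con 0ℚ) :* u :* v :* (a′ :* con 1ℚ)) refl s N⁻¹ [N-1]⁻¹ a (1/ a) (fromℕ m) ⟩
        (a * s + fromℕ m * 0ℚ) * N⁻¹ * [N-1]⁻¹ * (1/ a * 1ℚ)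
          ≡⟨ cong (λ z → z * N⁻¹ * [N-1]⁻¹ * (1/ a * 1ℚ)) (fromℤ-totalNumerator′ N 0 (ℕ.+-identityʳ N)) ⟨
        fromℤ (totalNumerator ℓ m N N) * N⁻¹ * [N-1]⁻¹ * (1/ a * 1ℚ)
          ≡⟨ cong₂ (λ z e → z * a ^ℤ e) (/-split (totalNumerator ℓ m N N)) (cong (ℤ._- ℤ.+ 1) (ℤ.+-inverseʳ (ℤ.+ N))) ⟨
        (totalNumerator ℓ m N N) /N[N-1] * a ^ℤ (ℤ.+ N ℤ.- ℤ.+ N ℤ.- ℤ.+ 1) ∎
        where
        s = fromℕ (suc n)
      last : lastTerm ≡ (totalNumerator ℓ m N N) /N[N-1]
          * a ^ℤ (ℤ.+ N ℤ.- ℤ.+ N ℤ.- ℤ.+ 1) * fromℕ ℓ ^ℕ N * fromℕ (N C N) * B N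
      last = cong (λ z → z * fromℕ ℓ ^ℕ N * fromℕ (N C N) * B N) cancel

theorem35 : ∀ (ℓ m : ℕ) .{{_ : NonZero ℓ}} .{{_ : NonZero m}} →
    (∀ (n : ℕ) .{{_ : NonZero n}} (i : Fin (ℓ ℕ.+ m)) → toℕ i < ℓ →
    ∃[ t ] (ColoredTreeRootedAt A⟨ ℓ , m ⟩ i n ↔ Fin t) × fromℕ t ≡ smallRootFormula ℓ m n)
    × (∀ (n : ℕ) .{{_ : NonTrivial n}} (i : Fin (ℓ ℕ.+ m)) → ℓ ≤ toℕ i →
    ∃[ t ] (ColoredTreeRootedAt A⟨ ℓ , m ⟩ i n ↔ Fin t) × fromℕ t ≡ largeRootFormula ℓ m n)
    × (∀ (n : ℕ) .{{_ : NonTrivial n}} →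
    ∃[ t ] (ColoredTree A⟨ ℓ , m ⟩ n ↔ Fin t)
    × ((m≢ℓ : m ≢ ℓ) → fromℕ t ≡ totalFormula ℓ m n m≢ℓ)
    × (m ≡ ℓ → fromℕ t ≡ totalFormulaCancelled ℓ m n))
theorem35 ℓ m = small , large , total
  where
  small : ∀ n .{{_ : NonZero n}} i → toℕ i < ℓ →
    ∃[ t ] (ColoredTreeRootedAt A⟨ ℓ , m ⟩ i n ↔ Fin t) × fromℕ t ≡ smallRootFormula ℓ m n
  small (suc n) i i<ℓ = _ , rootedAt↔Fin ℓ m i n (isLarge-< ℓ m i i<ℓ) , smallRoot-count ℓ m n

  large : ∀ n .{{_ : NonTrivial n}} i → ℓ ≤ toℕ i →
    ∃[ t ] (ColoredTreeRootedAt A⟨ ℓ , m ⟩ i n ↔ Fin t) × fromℕ t ≡ largeRootFormula ℓ m n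
  large (2+ n) i ℓ≤i = _ , rootedAt↔Fin ℓ m i (suc n) (isLarge-≥ ℓ m i ℓ≤i) , largeRoot-count ℓ m n

  total : ∀ n .{{_ : NonTrivial n}} → ∃[ t ] (ColoredTree A⟨ ℓ , m ⟩ n ↔ Fin t)
    × ((m≢ℓ : m ≢ ℓ) → fromℕ t ≡ totalFormula ℓ m n m≢ℓ)
    × (m ≡ ℓ → fromℕ t ≡ totalFormulaCancelled ℓ m n)
  total (2+ n) = _ , coloredTree↔Fin ℓ m (suc n)
    , (λ m≢ℓ → trans (total≡cancelled ℓ m n) (cancelled≡total ℓ m n m≢ℓ))
    , (λ _ → total≡cancelled ℓ m n)
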